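{- Let $\lambda$ be a wide partition and let $G=L(G_\lambda)$. Then the set of rows of the Young diagram of $\lambda$ (each row viewed as a complete subgraph of $G$) is a completely saturated clique cover of $G$. Moreover, $G$ satisfies $\Delta$-conjugacy and the t-phenomenon.
   Context: For partitions $\alpha,\beta$ of the same integer, $\alpha\ge\beta$ (dominance order) means $\sum_{k=1}^j\alpha_k\ge\sum_{k=1}^j\beta_k$ for all $j$ (parts padded by zeros); $\mu'$ is the conjugate of $\mu$. A partition $\mu$ is a subpartition of $\lambda$ if the multiset of parts of $\mu$ is a submultiset of the multiset of parts of $\lambda$ (equivalently, the Young diagram of $\mu$ is obtained by deleting some rows of that of $\lambda$). $\lambda$ is wide if $\mu\ge\mu'$ for every subpartition $\mu$ of $\lambda$. $G_\lambda$ is the bipartite graph whose vertices are the rows and the columns of the Young diagram of $\lambda$, with an edge between row $i$ and column $j$ iff $j\le\lambda_i$; $L(G_\lambda)$ is its line graph, whose vertices are the cells of the Young diagram, two cells adjacent iff they lie in the same row or same column. For a graph $G$: a $k$-clique is a union of $k$ complete subgraphs, a $k$-stable set a union of $k$ stable sets; $\omega_k$ (resp. $\alpha_k$) is the maximum number of vertices of a $k$-clique (resp. $k$-stable set), $\omega_0=\alpha_0=0$, $\Delta\omega_k=\omega_k-\omega_{k-1}$, $\Delta\alpha_k=\alpha_k-\alpha_{k-1}$. $G$ satisfies $\Delta$-conjugacy if $\Delta\omega$ and $\Delta\alpha$ are both nonincreasing (hence partitions) and are conjugate to each other. A clique cover (resp. stable set cover) is a family of vertex-disjoint complete subgraphs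 (resp. stable sets) covering all vertices; its sizes sorted decreasingly form a partition, also denoted by the cover's name. A clique cover $\nu$ is $k$-saturated if $\alpha_k=\sum_{i=1}^k\nu'_i$; a stable set cover $\nu$ is $k$-saturated if $\omega_k=\sum_{i=1}^k\nu'_i$; a cover is completely saturated if it is $k$-saturated for all positive integers $k$. $G$ satisfies the t-phenomenon if for every positive integer $k$ there is a clique cover that is both $k$-saturated and $(k+1)$-saturated, and a stable set cover that is both $k$-saturated and $(k+1)$-saturated. -}

module Defs where

open import Data.Nat using (ℕ; zero; suc; _+_; _∸_; _≤_; _<_; _≤?_)
open import Data.Nat.Properties using ()
open import Data.Bool using (true; false)
open import Data.List using (List; []; _∷_; length; map; upTo; concat; take)
open import Data.Nat.ListAction using (sum)
open import Data.List.Relation.Unary.All using (All)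
open import Data.List.Relation.Unary.Any using (Any)
open import Data.List.Relation.Unary.Linked using (Linked)
open import Data.List.Relation.Unary.Unique.Propositional using (Unique)
open import Data.List.Membership.Propositional using (_∈_)
open import Data.List.Relation.Binary.Sublist.Propositional using (_⊆_)
open import Data.Vec using (Vec; toList)
open import Data.Product using (Σ; ∃; _×_; _,_; proj₁; proj₂)
open import Data.Sum using (_⊎_)
open import Relation.Nullary using (¬_; yes; no)
open import Relation.Binary.PropositionalEquality using (_≡_; _≢_)
open import Function.Bundles using (_⇔_)

IsPartition : List ℕ → Set
IsPartition p = All (λ x → 1 ≤ x) p × Linked (λ a b → b ≤ a) p

countGe : ℕ → List ℕ → ℕ
countGe i []       = 0
countGe i (x ∷ xs) with i ≤? x
... | yes _ = suc (countGe i xs)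
... | no  _ = countGe i xs

head0 : List ℕ → ℕ
head0 []      = 0
head0 (x ∷ _) = x

conj : List ℕ → List ℕ
conj μ = map (λ j → countGe (suc j) μ) (upTo (head0 μ))

-- dominance order α ≥ β (parts padded by zeros; take pads implicitly)
_⊵_ : List ℕ → List ℕ → Set
α ⊵ β = ∀ j → sum (take j β) ≤ sum (take j α)

-- μ is a subpartition of λ: sub-multiset of parts. For a nonincreasing λ
-- the sub-multisets are exactly the (order-preserving) sublists.
Subpartition : List ℕ → List ℕ → Set
Subpartition μ p = μ ⊆ p

Wide : List ℕ → Set
Wide p = ∀ μ → Subpartition μ p → μ ⊵ conj μ

-- The graph L(G_λ): vertices are cells (i , j) (0-indexed row i, column j)
-- of the Young diagram; two distinct cells adjacent iff same row or column.

Cell : Set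
Cell = ℕ × ℕ

rowLen : List ℕ → ℕ → ℕ
rowLen []       _       = 0
rowLen (x ∷ _)  zero    = x
rowLen (_ ∷ xs) (suc i) = rowLen xs i

InDiag : List ℕ → Cell → Set
InDiag p (i , j) = j < rowLen p i

Adjacent : Cell → Cell → Set
Adjacent x y = x ≢ y × (proj₁ x ≡ proj₁ y ⊎ proj₂ x ≡ proj₂ y)

IsClique : List ℕ → List Cell → Set
IsClique p C = All (InDiag p) C ×
  (∀ {x y} → x ∈ C → y ∈ C → x ≢ y → Adjacent x y)

IsStable : List ℕ → List Cell → Set
IsStable p S = All (InDiag p) S ×
  (∀ {x y} → x ∈ S → y ∈ S → ¬ Adjacent x y)

UnionOf : (List Cell → Set) → ℕ → List Cell → Set
UnionOf P k S = Unique S ×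
  Σ (Vec (List Cell) k) (λ Cs → All P (toList Cs) ×
     (∀ x → (x ∈ S) ⇔ Any (x ∈_) (toList Cs)))

KClique : List ℕ → ℕ → List Cell → Set
KClique p = UnionOf (IsClique p)

KStable : List ℕ → ℕ → List Cell → Set
KStable p = UnionOf (IsStable p)

IsMax : (List Cell → Set) → ℕ → Set
IsMax Q m = (Σ (List Cell) λ S → Q S × length S ≡ m) ×
            (∀ S → Q S → length S ≤ m)

IsOmega : List ℕ → ℕ → ℕ → Set
IsOmega p k m = IsMax (KClique p k) m

IsAlpha : List ℕ → ℕ → ℕ → Set
IsAlpha p k m = IsMax (KStable p k) m

IsCover : List ℕ → (List Cell → Set) → List (List Cell) → Set
IsCover p P cov = All (λ C → P C × C ≢ []) cov ×
  Unique (concat cov) × (∀ c → (c ∈ concat cov) ⇔ InDiag p c)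

IsCliqueCover : List ℕ → List (List Cell) → Set
IsCliqueCover p = IsCover p (IsClique p)

IsStableCover : List ℕ → List (List Cell) → Set
IsStableCover p = IsCover p (IsStable p)

-- Σ_{i=1}^k ν'_i where ν is the partition of block sizes (ν'_i = #{blocks of size ≥ i})
conjSum : List (List Cell) → ℕ → ℕ
conjSum cov zero    = 0
conjSum cov (suc k) = conjSum cov k + countGe (suc k) (map length cov)

KSatClique : List ℕ → List (List Cell) → ℕ → Set
KSatClique p cov k = IsAlpha p k (conjSum cov k)

KSatStable : List ℕ → List (List Cell) → ℕ → Set
KSatStable p cov k = IsOmega p k (conjSum cov k)

CompletelySaturatedCliqueCover : List ℕ → List (List Cell) → Set
CompletelySaturatedCliqueCover p cov =
  IsCliqueCover p cov × (∀ k → 1 ≤ k → KSatClique p cov k)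

rowsFrom : ℕ → List ℕ → List (List Cell)
rowsFrom i []       = []
rowsFrom i (x ∷ xs) = map (λ j → (i , j)) (upTo x) ∷ rowsFrom (suc i) xs

rows : List ℕ → List (List Cell)
rows = rowsFrom 0

Δ : (ℕ → ℕ) → ℕ → ℕ
Δ f k = f k ∸ f (k ∸ 1)

Nonincreasing : (ℕ → ℕ) → Set
Nonincreasing d = ∀ k → 1 ≤ k → d (suc k) ≤ d k

-- sequences d, e (indexed from 1) are conjugate partitions: the Young
-- diagram {(i , j) : i , j ≥ 1, j ≤ d i} transposes to that of e
ConjugateSeq : (ℕ → ℕ) → (ℕ → ℕ) → Set
ConjugateSeq d e = ∀ i j → 1 ≤ i → 1 ≤ j → (j ≤ d i) ⇔ (i ≤ e j)

DeltaConjugacy : List ℕ → Set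
DeltaConjugacy p = Σ (ℕ → ℕ) λ ω → Σ (ℕ → ℕ) λ α →
  (∀ k → IsOmega p k (ω k)) × (∀ k → IsAlpha p k (α k)) ×
  Nonincreasing (Δ ω) × Nonincreasing (Δ α) × ConjugateSeq (Δ ω) (Δ α)

TPhenomenon : List ℕ → Set
TPhenomenon p = ∀ k → 1 ≤ k →
  (Σ (List (List Cell)) λ cov → IsCliqueCover p cov ×
     KSatClique p cov k × KSatClique p cov (suc k)) ×
  (Σ (List (List Cell)) λ cov → IsStableCover p cov ×
     KSatStable p cov k × KSatStable p cov (suc k))

{-# OPTIONS --safe #-}

-- A clique and a stable set share at most one cell, so a union of k cliques
-- has at most Σ min(k, |D|) cells, the sum over the blocks D of any stable set
-- cover, and dually. All upper bounds come from this; it remains to exhibit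
-- large unions and good covers.
--
-- For every j there are j disjoint stable sets containing Σ min(λ_i, j) cells
-- in total. Indeed wideness, applied to all subpartitions, is exactly the
-- max-flow min-cut condition for choosing min(λ_i, j) cells in each row i and
-- at most j in each column (proved by a Rado-style deletion argument), and by
-- König's theorem such a set of cells splits into j partial permutations.
-- This makes the rows completely saturated. Taking j = λ_{k+1}, the j stable
-- sets together with the remaining cells as singletons form a stable set
-- cover that is k- and (k+1)-saturated with ω_k = λ_1 + … + λ_k.
module Submission where

open import Defs
open import Data.Bool using (Bool; true; false; _∧_; _∨_; not; T; if_then_else_)
open import Data.Nat using (ℕ; zero; suc; _+_; _*_; _∸_; _⊓_; _≤_; _<_; _≤?_; _<?_; _≡ᵇ_; _<ᵇ_; z≤n; s≤s; z<s; s<s)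
open import Data.Nat.Properties
open import Data.Nat.Tactic.RingSolver using (solve-∀)
open import Data.Nat.ListAction using (sum)
open import Data.Nat.ListAction.Properties using (sum-++)
open import Data.Fin using (toℕ; fromℕ<)
open import Data.Fin.Properties using (any?; toℕ<n; toℕ-fromℕ<)
open import Data.Fin.Subset using (Subset)
open import Data.Fin.Subset.Properties using (anySubset?)
open import Data.List using (List; []; _∷_; [_]; _++_; length; map; upTo; applyUpTo; concat; take; drop; filter; replicate)
open import Data.List.Properties using (++-assoc; length-map; length-upTo; length-replicate; length-++; map-++; concat-++; concat-map-[_]; take-[]; length-filter)
open import Data.List.Membership.Propositional using (_∈_; _∉_)
import Data.List.Membership.DecPropositional as DecMembership
open import Data.List.Membership.Propositional.Properties using (∈-∃++; ∈-concat⁺; ∈-concat⁻; ∈-concat⁺′; ∈-filter⁺; ∈-filter⁻; ∈-map⁺; ∈-map⁻; ∈-upTo⁺; ∈-upTo⁻; ∈-++⁺ˡ; ∈-++⁺ʳ; ∈-++⁻)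
open import Data.List.Relation.Binary.Disjoint.Propositional using (Disjoint)
open import Data.List.Relation.Binary.Permutation.Propositional using (_↭_; ↭-refl; ↭-sym; ↭-trans; ↭-reflexive; ↭⇒↭ₛ; prep; swap; module PermutationReasoning)
import Data.List.Relation.Binary.Permutation.Propositional as Perm
open import Data.List.Relation.Binary.Permutation.Propositional.Properties using (All-resp-↭; ↭-length; ++⁺ˡ; ++⁺ʳ; ++⁺; shift; shifts)
import Data.List.Relation.Binary.Permutation.Setoid.Properties as PermSetoid
open import Data.List.Relation.Binary.Sublist.Propositional using (_⊆_; []; _∷_; _∷ʳ_)
open import Data.List.Relation.Unary.All as All using (All; []; _∷_)
import Data.List.Relation.Unary.All.Properties as Allₚ
import Data.List.Relation.Unary.Any.Properties as Anyₚ
open import Data.List.Relation.Unary.Linked.Properties using (Linked⇒AllPairs)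
open import Data.List.Relation.Binary.Sublist.Propositional.Properties using (All-resp-⊆)
open import Data.List.Relation.Unary.AllPairs using (AllPairs; []; _∷_)
open import Data.List.Relation.Unary.Any as Any using (Any; here; there)
open import Data.List.Relation.Unary.Unique.Propositional using (Unique)
import Data.List.Relation.Unary.Unique.Propositional.Properties as Uniqueₚ
open import Data.Product using (∃; ∃₂; _×_; _,_; proj₁; proj₂)
open import Data.Product.Properties using (≡-dec)
open import Data.Sum using (_⊎_; inj₁; inj₂; [_,_]′)
open import Data.Vec using ([]; _∷_; toList; fromList)
open import Data.Vec.Properties using (toList∘fromList; length-toList)
open import Function using (_∘_; id)
open import Function.Bundles using (_⇔_; mk⇔; Equivalence)
open import Relation.Binary.Definitions using (Symmetric)
open import Relation.Binary.PropositionalEquality using (_≡_; _≢_; refl; sym; trans; cong; cong₂; subst; setoid; resp₂; ≢-sym)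
open import Relation.Nullary using (¬_; Dec; yes; no; contradiction; ¬?)
open import Relation.Nullary.Decidable using (dec-true; dec-false)

-- Lists and counting

AllPairs-resp-↭ : ∀ {A : Set} {R : A → A → Set} → Symmetric R →
  ∀ {xs ys} → xs ↭ ys → AllPairs R xs → AllPairs R ys
AllPairs-resp-↭ {A} {R} R-sym p =
  PermSetoid.AllPairs-resp-↭ (setoid A) R-sym (resp₂ R) (↭⇒↭ₛ p)

Unique-resp-↭ : ∀ {A : Set} {xs ys : List A} → xs ↭ ys → Unique xs → Unique ys
Unique-resp-↭ = AllPairs-resp-↭ ≢-sym

concat-resp-↭ : ∀ {A : Set} {xss yss : List (List A)} →
  xss ↭ yss → concat xss ↭ concat yss
concat-resp-↭ Perm.refl            = ↭-refl
concat-resp-↭ (prep xs p)          = ++⁺ˡ xs (concat-resp-↭ p)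
concat-resp-↭ (swap xs ys p)       =
  ↭-trans (shifts xs ys) (++⁺ˡ ys (++⁺ˡ xs (concat-resp-↭ p)))
concat-resp-↭ (Perm.trans p q)     = ↭-trans (concat-resp-↭ p) (concat-resp-↭ q)

∈⇒↭∷ : ∀ {A : Set} {x : A} {xs} → x ∈ xs → ∃ λ ys → xs ↭ x ∷ ys
∈⇒↭∷ {x = x} x∈xs with ys , zs , refl ← ∈-∃++ x∈xs = ys ++ zs , shift x ys zs

ind : Bool → ℕ
ind true  = 1
ind false = 0

count : ∀ {A : Set} → (A → Bool) → List A → ℕ
count P []       = 0
count P (x ∷ xs) = ind (P x) + count P xs

module _ {A : Set} where

  count-++ : ∀ (P : A → Bool) xs ys → count P (xs ++ ys) ≡ count P xs + count P ys
  count-++ P []       ys = refl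
  count-++ P (x ∷ xs) ys =
    trans (cong (ind (P x) +_) (count-++ P xs ys)) (sym (+-assoc (ind (P x)) _ _))

  count-↭ : ∀ (P : A → Bool) {xs ys} → xs ↭ ys → count P xs ≡ count P ys
  count-↭ P Perm.refl        = refl
  count-↭ P (prep x p)       = cong (ind (P x) +_) (count-↭ P p)
  count-↭ P {ys = _ ∷ _ ∷ ys} (swap x y p) = trans
    (cong (λ n → ind (P x) + (ind (P y) + n)) (count-↭ P p))
    (lemma (ind (P x)) (ind (P y)) (count P ys))
    where
    lemma : ∀ a b c → a + (b + c) ≡ b + (a + c)
    lemma = solve-∀
  count-↭ P (Perm.trans p q) = trans (count-↭ P p) (count-↭ P q)

≡ᵇ-refl : ∀ n → (n ≡ᵇ n) ≡ true
≡ᵇ-refl zero    = refl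
≡ᵇ-refl (suc n) = ≡ᵇ-refl n

-- Edge colouring

Free : (Cell → ℕ) → ℕ → List Cell → Set
Free f v = All (λ x → v ≢ f x)

deg : (Cell → ℕ) → ℕ → List Cell → ℕ
deg f v = count (λ x → f x ≡ᵇ v)

-- In the second case a permutation brings the offending cell to the front, so that it can be taken
-- out and the rest of the class kept.
free⊎used : ∀ f v xs → Free f v xs ⊎ ∃₂ λ x ys → v ≡ f x × xs ↭ x ∷ ys
free⊎used f v []       = inj₁ []
free⊎used f v (x ∷ xs) with v ≟ f x | free⊎used f v xs
... | yes v≡fx | _       = inj₂ (x , xs , v≡fx , ↭-refl)
... | no  v≢fx | inj₁ fr = inj₁ (v≢fx ∷ fr)
... | no  v≢fx | inj₂ (y , ys , v≡fy , p) =
  inj₂ (y , x ∷ ys , v≡fy , ↭-trans (prep x p) (swap x y ↭-refl))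

used⇒deg>0 : ∀ f {v x xs ys} → v ≡ f x → xs ↭ x ∷ ys → 1 ≤ deg f v xs
used⇒deg>0 f {x = x} {ys = ys} refl p
  rewrite count-↭ (λ y → f y ≡ᵇ f x) p | ≡ᵇ-refl (f x) = s≤s z≤n

-- Pigeonhole: every class that uses `v` contributes at least one to the degree of `v`, so not all
-- classes can use it.
∃-free-class : ∀ f v css → deg f v (concat css) < length css →
  ∃₂ λ C rest → css ↭ C ∷ rest × Free f v C
∃-free-class f v (C ∷ css) d< with free⊎used f v C
... | inj₁ fr = C , css , ↭-refl , fr
... | inj₂ (x , ys , v≡fx , p)
  with D , rest , q , fr ← ∃-free-class f v css
         (≤-pred (≤-trans (s≤s (≤-trans (+-monoˡ-≤ _ (used⇒deg>0 f v≡fx p))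
                                  (≤-reflexive (sym (count-++ _ C (concat css)))))) d<))
  = D , C ∷ rest , ↭-trans (prep C q) (swap C D ↭-refl) , fr

Apart : Cell → Cell → Set
Apart x y = proj₁ x ≢ proj₁ y × proj₂ x ≢ proj₂ y

Apart-sym : Symmetric Apart
Apart-sym (r≢ , c≢) = ≢-sym r≢ , ≢-sym c≢

-- A partial permutation matrix. Unlike `IsStable`, this also rules out repeated entries, since no
-- cell is `Apart` from itself.
Matching : List Cell → Set
Matching = AllPairs Apart

matching-∷ : ∀ {r c xs} → Free proj₁ r xs → Free proj₂ c xs → Matching xs → Matching ((r , c) ∷ xs)
matching-∷ fr fc m = All.zip (fr , fc) ∷ m

-- The alternating path argument: insert (r , c) into B; a B-edge at r that
-- is in the way moves to A, and the A-edge which that one blocks is in turn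
-- inserted into what remains of B. The two column conditions say that the
-- path never comes back to c.
kempe : ∀ n A B r c → length A ≤ n → Matching A → Matching B →
  Free proj₁ r A → Free proj₂ c B →
  ∃₂ λ A′ B′ → Matching A′ × Matching B′ × A′ ++ B′ ↭ (r , c) ∷ A ++ B ×
    (∀ {y} → y ≢ c → Free proj₂ y B → Free proj₂ y B′) ×
    (∀ {y} → Free proj₂ y A → Free proj₂ y B → Free proj₂ y A′)
kempe n A B r c |A|≤n mA mB rA cB with free⊎used proj₁ r B
... | inj₁ rB = A , (r , c) ∷ B , mA , matching-∷ rB cB mB , shift (r , c) A B ,
      (λ y≢c yB → y≢c ∷ yB) , (λ yA _ → yA)
... | inj₂ ((.r , c₁) , B₁ , refl , pB)
  with r,c₁#B₁ ∷ mB₁ ← AllPairs-resp-↭ Apart-sym pB mB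
  with c≢c₁ ∷ cB₁ ← All-resp-↭ pB cB
  with rB₁ ← All.map proj₁ r,c₁#B₁ | c₁B₁ ← All.map proj₂ r,c₁#B₁
  with free⊎used proj₂ c₁ A
... | inj₁ c₁A = (r , c₁) ∷ A , (r , c) ∷ B₁ ,
      matching-∷ rA c₁A mA , matching-∷ rB₁ cB₁ mB₁ , perm ,
      (λ y≢c yB → y≢c ∷ All.tail (All-resp-↭ pB yB)) ,
      (λ yA yB → All.head (All-resp-↭ pB yB) ∷ yA)
      where
      open PermutationReasoning
      perm : (r , c₁) ∷ A ++ (r , c) ∷ B₁ ↭ (r , c) ∷ A ++ B
      perm = begin
        (r , c₁) ∷ A ++ (r , c) ∷ B₁   ↭⟨ shift (r , c) ((r , c₁) ∷ A) B₁ ⟩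
        (r , c) ∷ (r , c₁) ∷ A ++ B₁   ↭⟨ prep (r , c) (shift (r , c₁) A B₁) ⟨
        (r , c) ∷ A ++ (r , c₁) ∷ B₁   ↭⟨ prep (r , c) (++⁺ˡ A pB) ⟨
        (r , c) ∷ A ++ B               ∎
kempe zero A B r c |A|≤n mA mB rA cB | _ | inj₂ (_ , _ , _ , pA) =
  contradiction (≤-trans (≤-reflexive (sym (↭-length pA))) |A|≤n) λ ()
kempe (suc n) A B r c |A|≤n mA mB rA cB | inj₂ ((.r , c₁) , B₁ , refl , pB)
  | inj₂ ((r₁ , .c₁) , A₁ , refl , pA)
  with r₁,c₁#A₁ ∷ mA₁ ← AllPairs-resp-↭ Apart-sym pA mA
  with r≢r₁ ∷ rA₁ ← All-resp-↭ pA rA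
  with A′ , B′ , mA′ , mB′ , p , colB , colA ←
    kempe n A₁ B₁ r₁ c₁ (≤-pred (≤-trans (≤-reflexive (sym (↭-length pA))) |A|≤n))
      mA₁ mB₁ (All.map proj₁ r₁,c₁#A₁) c₁B₁
  -- Row `r` is absent from everything handed to the recursion, hence by `p` from both results, so
  -- one edge at `r` can be added to each.
  with rA′ , rB′ ← Allₚ.++⁻ A′ (All-resp-↭ (↭-sym p) (r≢r₁ ∷ Allₚ.++⁺ rA₁ rB₁))
  = (r , c₁) ∷ A′ , (r , c) ∷ B′ ,
    -- Column `c₁` is free in both `A₁` and `B₁`, hence in `A′`; column `c` differs from `c₁` and is
    -- free in `B₁`, hence in `B′`.
    matching-∷ rA′ (colA (All.map proj₂ r₁,c₁#A₁) c₁B₁) mA′ ,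
    matching-∷ rB′ (colB c≢c₁ cB₁) mB′ , perm ,
    (λ y≢c yB → let yB⁺ = All-resp-↭ pB yB in y≢c ∷ colB (All.head yB⁺) (All.tail yB⁺)) ,
    (λ yA yB → let yA⁺ = All-resp-↭ pA yA in
      All.head yA⁺ ∷ colA (All.tail yA⁺) (All.tail (All-resp-↭ pB yB)))
  where
  open PermutationReasoning
  perm : (r , c₁) ∷ A′ ++ (r , c) ∷ B′ ↭ (r , c) ∷ A ++ B
  perm = begin
    (r , c₁) ∷ A′ ++ (r , c) ∷ B′              ↭⟨ shift (r , c) ((r , c₁) ∷ A′) B′ ⟩
    (r , c) ∷ (r , c₁) ∷ A′ ++ B′              ↭⟨ prep _ (prep _ p) ⟩
    (r , c) ∷ (r , c₁) ∷ (r₁ , c₁) ∷ A₁ ++ B₁  ↭⟨ prep _ (shift (r , c₁) ((r₁ , c₁) ∷ A₁) B₁) ⟨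
    (r , c) ∷ (r₁ , c₁) ∷ A₁ ++ (r , c₁) ∷ B₁  ↭⟨ prep _ (++⁺ pA pB) ⟨
    (r , c) ∷ A ++ B                           ∎

deg-∷ : ∀ f e E → deg f (f e) (e ∷ E) ≡ suc (deg f (f e) E)
deg-∷ f e E rewrite ≡ᵇ-refl (f e) = refl

-- The edges are inserted one at a time. By the row degrees some class `A` misses row `r`. If it
-- also misses column `c`, the new edge joins it; otherwise another class `B` misses `c`, and
-- `kempe` redistributes the two classes together with the new edge.
könig : ∀ j E → (∀ r → deg proj₁ r E ≤ j) → (∀ c → deg proj₂ c E ≤ j) →
  ∃ λ css → length css ≡ j × All Matching css × concat css ↭ E
könig j [] _ _ = replicate j [] , length-replicate j , Allₚ.replicate⁺ j [] , ↭-reflexive (concat-[] j)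
  where
  concat-[] : ∀ k → concat (replicate k []) ≡ ([] {A = Cell})
  concat-[] zero    = refl
  concat-[] (suc k) = concat-[] k
könig j (e@(r , c) ∷ E) degr degc
  with css , refl , ms , p ←
    könig j E (λ v → m+n≤o⇒n≤o _ (degr v)) (λ v → m+n≤o⇒n≤o _ (degc v))
  with A , R , q , rA ← ∃-free-class proj₁ r css
    (subst (_≤ length css)
      (trans (deg-∷ proj₁ e E) (cong suc (sym (count-↭ _ p)))) (degr r))
  with mA ∷ mR ← All-resp-↭ q ms
  with free⊎used proj₂ c A
... | inj₁ cA = (e ∷ A) ∷ R , sym (↭-length q) , matching-∷ rA cA mA ∷ mR ,
      prep e (↭-trans (↭-sym (concat-resp-↭ q)) p)
... | inj₂ (_ , _ , c≡ , pA)
  -- As `A` uses column `c`, its edge there and the new one account for two of the at most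
  -- `suc (length R)` edges in that column, so some class of `R` is free of `c`.
  with B , R′ , q′ , cB ← ∃-free-class proj₂ c R (let open ≤-Reasoning in ≤-pred (begin
    2 + deg proj₂ c (concat R)                  ≤⟨ s≤s (+-monoˡ-≤ _ (used⇒deg>0 proj₂ c≡ pA)) ⟩
    suc (deg proj₂ c A + deg proj₂ c (concat R)) ≡⟨ cong suc (count-++ _ A (concat R)) ⟨
    suc (deg proj₂ c (concat (A ∷ R)))           ≡⟨ cong suc (count-↭ _ (concat-resp-↭ q)) ⟨
    suc (deg proj₂ c (concat css))               ≡⟨ cong suc (count-↭ _ p) ⟩
    suc (deg proj₂ c E)                          ≡⟨ deg-∷ proj₂ e E ⟨
    deg proj₂ c (e ∷ E)                          ≤⟨ degc c ⟩
    length css                                   ≡⟨ ↭-length q ⟩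
    suc (length R)                               ∎))
  with mB ∷ mR′ ← All-resp-↭ q′ mR
  with A′ , B′ , mA′ , mB′ , p′ , _ ← kempe (length A) A B r c ≤-refl mA mB rA cB
  = A′ ∷ B′ ∷ R′ ,
    trans (cong suc (sym (↭-length q′))) (sym (↭-length q)) ,
    mA′ ∷ mB′ ∷ mR′ ,
    ↭-trans (↭-reflexive (sym (++-assoc A′ B′ (concat R′))))
      (↭-trans (++⁺ʳ (concat R′) p′)
        (prep e (↭-trans (↭-reflexive (++-assoc A B (concat R′)))
          (↭-trans (↭-sym (↭-trans (concat-resp-↭ q) (++⁺ˡ A (concat-resp-↭ q′)))) p))))

-- Finite sums and double counting

Sum : ℕ → (ℕ → ℕ) → ℕ
Sum zero    f = 0
Sum (suc n) f = f 0 + Sum n (f ∘ suc)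

Sum-cong : ∀ n {f g} → (∀ i → i < n → f i ≡ g i) → Sum n f ≡ Sum n g
Sum-cong zero    f≡g = refl
Sum-cong (suc n) f≡g = cong₂ _+_ (f≡g 0 z<s) (Sum-cong n λ i i<n → f≡g (suc i) (s<s i<n))

Sum-mono : ∀ n {f g} → (∀ i → i < n → f i ≤ g i) → Sum n f ≤ Sum n g
Sum-mono zero    f≤g = z≤n
Sum-mono (suc n) f≤g = +-mono-≤ (f≤g 0 z<s) (Sum-mono n λ i i<n → f≤g (suc i) (s<s i<n))

Sum-0 : ∀ n → Sum n (λ _ → 0) ≡ 0
Sum-0 zero    = refl
Sum-0 (suc n) = Sum-0 n

+-interchange : ∀ a b c d → (a + b) + (c + d) ≡ (a + c) + (b + d)
+-interchange = solve-∀

Sum-+ : ∀ n f g → Sum n (λ i → f i + g i) ≡ Sum n f + Sum n g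
Sum-+ zero    f g = refl
Sum-+ (suc n) f g = trans (cong (f 0 + g 0 +_) (Sum-+ n (f ∘ suc) (g ∘ suc)))
  (+-interchange (f 0) (g 0) _ _)

Sum-< : ∀ n {f g} → Sum n f < Sum n g → ∃ λ i → f i < g i
Sum-< (suc n) {f} {g} lt with f 0 <? g 0
... | yes f0<g0 = 0 , f0<g0
... | no  f0≮g0 with i , fi<gi ← Sum-< n (+-cancelˡ-< (g 0) _ _
                       (≤-<-trans (+-monoˡ-≤ _ (≮⇒≥ f0≮g0)) lt)) = suc i , fi<gi

Sum-mono-< : ∀ n {f g} → (∀ i → f i ≤ g i) → ∀ i → i < n → f i < g i → Sum n f < Sum n g
Sum-mono-< (suc n) f≤g zero    _         lt = +-mono-<-≤ lt (Sum-mono n λ i _ → f≤g (suc i))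
Sum-mono-< (suc n) f≤g (suc i) (s≤s i<n) lt =
  +-mono-≤-< (f≤g 0) (Sum-mono-< n (f≤g ∘ suc) i i<n lt)

Sum-ind : ∀ n {v} (h : ℕ → ℕ) → v < n → Sum n (λ i → ind (v ≡ᵇ i) * h i) ≡ h v
Sum-ind (suc n) {zero}  h _         =
  trans (cong₂ _+_ (+-identityʳ (h 0)) (Sum-0 n)) (+-identityʳ (h 0))
Sum-ind (suc n) {suc v} h (s≤s v<n) = Sum-ind n (h ∘ suc) v<n

ind-∧ : ∀ a b → ind (a ∧ b) ≡ ind a * ind b
ind-∧ true  b = sym (+-identityʳ (ind b))
ind-∧ false b = refl

Sum-ind-∧ : ∀ n {v} b → v < n → Sum n (λ i → ind ((v ≡ᵇ i) ∧ b)) ≡ ind b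
Sum-ind-∧ n {v} b v<n = trans (Sum-cong n λ i _ → ind-∧ (v ≡ᵇ i) b) (Sum-ind n (λ _ → ind b) v<n)

module _ {A : Set} where

  count-cong : ∀ {P Q : A → Bool} {xs} → All (λ x → P x ≡ Q x) xs → count P xs ≡ count Q xs
  count-cong []         = refl
  count-cong (eq ∷ eqs) = cong₂ _+_ (cong ind eq) (count-cong eqs)

  count-mono : ∀ {P Q : A → Bool} xs → (∀ x → ind (P x) ≤ ind (Q x)) → count P xs ≤ count Q xs
  count-mono []       le = z≤n
  count-mono (x ∷ xs) le = +-mono-≤ (le x) (count-mono xs le)

  count-modular : ∀ {P Q R S : A → Bool} xs →
    (∀ x → ind (P x) + ind (Q x) ≡ ind (R x) + ind (S x)) →
    count P xs + count Q xs ≡ count R xs + count S xs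
  count-modular []       eq = refl
  count-modular {P} {Q} {R} {S} (x ∷ xs) eq =
    trans (+-interchange (ind (P x)) _ _ _)
      (trans (cong₂ _+_ (eq x) (count-modular xs eq))
        (+-interchange (ind (R x)) _ _ _))

  count-none : ∀ xs → count {A} (λ _ → false) xs ≡ 0
  count-none []       = refl
  count-none (_ ∷ xs) = count-none xs

  count-all : ∀ xs → count {A} (λ _ → true) xs ≡ length xs
  count-all []       = refl
  count-all (_ ∷ xs) = cong suc (count-all xs)

  count-witness : ∀ (P : A → Bool) xs → count P xs ≡ 0 ⊎ ∃ λ x → x ∈ xs × P x ≡ true
  count-witness P []       = inj₁ refl
  count-witness P (x ∷ xs) with P x in eq | count-witness P xs
  ... | true  | _                    = inj₂ (x , here refl , eq)
  ... | false | inj₁ eq0             = inj₁ eq0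
  ... | false | inj₂ (y , y∈xs , py) = inj₂ (y , there y∈xs , py)

  Sum-count : ∀ n (f : A → ℕ) (P : A → Bool) {xs} → All (λ x → f x < n) xs →
    Sum n (λ c → count (λ x → (f x ≡ᵇ c) ∧ P x) xs) ≡ count P xs
  Sum-count n f P []         = Sum-0 n
  Sum-count n f P {x ∷ xs} (fx<n ∷ fxs<n) =
    trans (Sum-+ n (λ c → ind ((f x ≡ᵇ c) ∧ P x)) _)
      (cong₂ _+_ (Sum-ind-∧ n (P x) fx<n) (Sum-count n f P fxs<n))

≡ᵇ⇒≡′ : ∀ {m n} → (m ≡ᵇ n) ≡ true → m ≡ n
≡ᵇ⇒≡′ {m} {n} eq = ≡ᵇ⇒≡ m n (subst T (sym eq) _)

∧-true : ∀ {a b} → a ∧ b ≡ true → a ≡ true × b ≡ true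
∧-true {true} {true} _ = refl , refl

∧-identityʳ′ : ∀ a → a ≡ a ∧ true
∧-identityʳ′ true  = refl
∧-identityʳ′ false = refl

-- Concavity of `j ⊓_`: the pair `d`, `u` has the same sum as `a`, `b` but lies further apart.
-- Applied to the column counts of an intersection and a union of row sets, it makes `cap`
-- submodular.
⊓-submodular : ∀ j {d a b u} → d ≤ a → d ≤ b → d + u ≡ a + b → j ⊓ d + j ⊓ u ≤ j ⊓ a + j ⊓ b
⊓-submodular j {d} {a} {b} {u} d≤a d≤b eq with ≤-total a j | ≤-total b j
... | inj₁ a≤j | inj₁ b≤j = begin
  j ⊓ d + j ⊓ u ≤⟨ +-mono-≤ (m⊓n≤n j d) (m⊓n≤n j u) ⟩
  d + u         ≡⟨ eq ⟩
  a + b         ≡⟨ cong₂ _+_ (m≥n⇒m⊓n≡n a≤j) (m≥n⇒m⊓n≡n b≤j) ⟨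
  j ⊓ a + j ⊓ b ∎
  where open ≤-Reasoning
... | inj₂ j≤a | _ = begin
  j ⊓ d + j ⊓ u ≤⟨ +-mono-≤ (⊓-monoʳ-≤ j d≤b) (m⊓n≤m j u) ⟩
  j ⊓ b + j     ≡⟨ +-comm (j ⊓ b) j ⟩
  j + j ⊓ b     ≡⟨ cong (_+ j ⊓ b) (m≤n⇒m⊓n≡m j≤a) ⟨
  j ⊓ a + j ⊓ b ∎
  where open ≤-Reasoning
... | inj₁ _ | inj₂ j≤b = begin
  j ⊓ d + j ⊓ u ≤⟨ +-mono-≤ (⊓-monoʳ-≤ j d≤a) (m⊓n≤m j u) ⟩
  j ⊓ a + j     ≡⟨ cong (j ⊓ a +_) (m≤n⇒m⊓n≡m j≤b) ⟨
  j ⊓ a + j ⊓ b ∎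
  where open ≤-Reasoning

⊓-suc-< : ∀ j k → j ⊓ k < j ⊓ suc k → suc k ≤ j
⊓-suc-< j k lt with j ≤? k
... | no  j≰k = ≰⇒> j≰k
... | yes j≤k = contradiction (≤-trans lt (m⊓n≤m j (suc k)))
                  (<-irrefl (m≤n⇒m⊓n≡m j≤k))

⊓-+-≤ : ∀ j a k → j ⊓ (a + k) ≤ a + j ⊓ k
⊓-+-≤ j a k = begin
  j ⊓ (a + k)       ≤⟨ ⊓-monoˡ-≤ (a + k) (m≤n+m j a) ⟩
  (a + j) ⊓ (a + k) ≡⟨ +-distribˡ-⊓ a j k ⟨
  a + j ⊓ k         ∎
  where open ≤-Reasoning

-- Row sets as bit vectors, with every row past the end left out: a finite type that can be searched
-- for a violation of the min-cut condition.
⟨_⟩ : ∀ {n} → Subset n → ℕ → Bool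
⟨ []    ⟩ _       = false
⟨ b ∷ _ ⟩ zero    = b
⟨ _ ∷ v ⟩ (suc i) = ⟨ v ⟩ i

restrict : ∀ n → (ℕ → Bool) → Subset n
restrict zero    g = []
restrict (suc n) g = g 0 ∷ restrict n (g ∘ suc)

restrict-≡ : ∀ n g i → i < n → ⟨ restrict n g ⟩ i ≡ g i
restrict-≡ (suc n) g zero    _         = refl
restrict-≡ (suc n) g (suc i) (s≤s i<n) = restrict-≡ n (g ∘ suc) i i<n

-- A constructive dichotomy for `delete`, which needs either one removable cell or a blocking set
-- for every cell of the row.
first⊎all : ∀ {A X : Set} {B : X → Set} (xs : List X) →
  (∀ {x} → x ∈ xs → A ⊎ B x) → A ⊎ (∀ {x} → x ∈ xs → B x)
first⊎all []       f = inj₂ λ ()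
first⊎all (x ∷ xs) f with f (here refl) | first⊎all xs (f ∘ there)
... | inj₁ a | _      = inj₁ a
... | inj₂ b | inj₁ a = inj₁ a
... | inj₂ b | inj₂ h = inj₂ λ { (here refl) → b ; (there x∈) → h x∈ }

-- Degree-constrained subgraphs

module Deletion (n m j : ℕ) (r : ℕ → ℕ) where

  cnt : List Cell → (ℕ → Bool) → ℕ → ℕ
  cnt E g c = count (λ x → (proj₂ x ≡ᵇ c) ∧ g (proj₁ x)) E

  -- With the rows of `g` on the source side of a cut, each column takes the cheaper option: cut its
  -- edge to the sink, at cost `j`, or cut its cells in those rows.
  cap : List Cell → (ℕ → Bool) → ℕ
  cap E g = Sum m (λ c → j ⊓ cnt E g c)

  dem : (ℕ → Bool) → ℕ
  dem g = Sum n (λ i → ind (g i) * r i)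

  -- Max-flow min-cut condition for r i cells of E in each row i and at most
  -- j in each column.
  Hall : List Cell → Set
  Hall E = ∀ g → dem g ≤ cap E g

  Within : List Cell → Set
  Within = All (λ x → proj₁ x < n × proj₂ x < m)

  dem-cong : ∀ {g h} → (∀ i → i < n → g i ≡ h i) → dem g ≡ dem h
  dem-cong g≡h = Sum-cong n λ i i<n → cong (λ b → ind b * r i) (g≡h i i<n)

  cap-cong : ∀ {E g h} → Within E → (∀ i → i < n → g i ≡ h i) → cap E g ≡ cap E h
  cap-cong wE g≡h = Sum-cong m λ c _ → cong (j ⊓_)
    (count-cong (All.map (λ {x} w → cong ((proj₂ x ≡ᵇ c) ∧_) (g≡h _ (proj₁ w))) wE))

  cap-↭ : ∀ {E F} → E ↭ F → ∀ g → cap E g ≡ cap F g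
  cap-↭ p g = Sum-cong m λ c _ → cong (j ⊓_) (count-↭ _ p)

  -- Demand and capacity depend on `g` only below `n`, so testing the finitely many bit vectors
  -- suffices.
  hall? : ∀ E → Within E → Hall E ⊎ ∃ λ g → cap E g < dem g
  hall? E wE with anySubset? {n} (λ v → cap E ⟨ v ⟩ <? dem ⟨ v ⟩)
  ... | yes (v , lt) = inj₂ (⟨ v ⟩ , lt)
  ... | no  none     = inj₁ λ g →
    subst (_≤ cap E g) (dem-cong (restrict-≡ n g))
      (subst (dem ⟨ restrict n g ⟩ ≤_) (cap-cong wE (restrict-≡ n g))
        (≮⇒≥ λ lt → none (restrict n g , lt)))

  Tight : List Cell → (ℕ → Bool) → Set
  Tight E g = cap E g ≤ dem g

  -- Under `Hall`, tightness is equality. For a cell `x` of `E` the other two conditions say that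
  -- its loss lowers `cap` by one: its row is counted, and its column is not cut off at `j`.
  Blocks : List Cell → Cell → (ℕ → Bool) → Set
  Blocks E x g = Tight E g × g (proj₁ x) ≡ true × cnt E g (proj₂ x) ≤ j

  -- Deleting one cell lowers `cap` by at most one. A set that is violated afterwards was therefore
  -- tight before, and its capacity must have dropped.
  blocks : ∀ {E E′ x g} → Hall E → Within E → E ↭ x ∷ E′ → cap E′ g < dem g → Blocks E x g
  blocks {E} {E′} {x} {g} hE wE p lt = tight , proj₁ saturated , proj₂ saturated
    where
    open ≤-Reasoning
    x<m : proj₂ x < m
    x<m = proj₂ (All.head (All-resp-↭ p wE))

    tight : Tight E g
    tight = begin
      cap E g        ≡⟨ cap-↭ p g ⟩
      cap (x ∷ E′) g ≤⟨ Sum-mono m (λ c _ → ⊓-+-≤ j (ind ((proj₂ x ≡ᵇ c) ∧ g (proj₁ x))) (cnt E′ g c)) ⟩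
      Sum m (λ c → ind ((proj₂ x ≡ᵇ c) ∧ g (proj₁ x)) + j ⊓ cnt E′ g c)
                     ≡⟨ Sum-+ m _ _ ⟩
      Sum m (λ c → ind ((proj₂ x ≡ᵇ c) ∧ g (proj₁ x))) + cap E′ g
                     ≡⟨ cong (_+ cap E′ g) (Sum-ind-∧ m (g (proj₁ x)) x<m) ⟩
      ind (g (proj₁ x)) + cap E′ g
                     ≤⟨ +-monoˡ-≤ _ (ind≤1 (g (proj₁ x))) ⟩
      suc (cap E′ g) ≤⟨ lt ⟩
      dem g          ∎
      where
      ind≤1 : ∀ b → ind b ≤ 1
      ind≤1 true  = ≤-refl
      ind≤1 false = z≤n

    saturated : g (proj₁ x) ≡ true × cnt E g (proj₂ x) ≤ j
    -- By `Hall` for `E` the term of some column drops. This can only be the column of `x`, with the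
    -- row of `x` selected and a count that was not above `j`.
    saturated with c , lt′ ← Sum-< m (<-≤-trans lt (≤-trans (hE g) (≤-reflexive (cap-↭ p g))))
      with proj₂ x ≡ᵇ c in eq | g (proj₁ x) in gx
    ... | false | _     = contradiction lt′ (<-irrefl refl)
    ... | true  | false = contradiction lt′ (<-irrefl refl)
    ... | true  | true with refl ← ≡ᵇ⇒≡′ {proj₂ x} {c} eq = refl , (begin
      cnt E g c        ≡⟨ count-↭ _ p ⟩
      cnt (x ∷ E′) g c ≡⟨ cong₂ (λ a b → ind (a ∧ b) + cnt E′ g c) eq gx ⟩
      suc (cnt E′ g c) ≤⟨ ⊓-suc-< j _ lt′ ⟩
      j                ∎)

  _∩_ _∪_ : (ℕ → Bool) → (ℕ → Bool) → ℕ → Bool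
  (g ∩ h) i = g i ∧ h i
  (g ∪ h) i = g i ∨ h i

  ind-∩-∪ : ∀ a b → ind (a ∧ b) + ind (a ∨ b) ≡ ind a + ind b
  ind-∩-∪ true  true  = refl
  ind-∩-∪ true  false = refl
  ind-∩-∪ false true  = refl
  ind-∩-∪ false false = refl

  dem-∩-∪ : ∀ g h → dem (g ∩ h) + dem (g ∪ h) ≡ dem g + dem h
  dem-∩-∪ g h = trans (sym (Sum-+ n _ _)) (trans
    (Sum-cong n λ i _ → trans (sym (*-distribʳ-+ (r i) (ind (g i ∧ h i)) _))
      (trans (cong (_* r i) (ind-∩-∪ (g i) (h i))) (*-distribʳ-+ (r i) (ind (g i)) _)))
    (Sum-+ n _ _))

  cnt-∩ˡ : ∀ E g h c → cnt E (g ∩ h) c ≤ cnt E g c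
  cnt-∩ˡ E g h c = count-mono E λ x → lemma (proj₂ x ≡ᵇ c) (g (proj₁ x)) (h (proj₁ x))
    where
    lemma : ∀ a b d → ind (a ∧ b ∧ d) ≤ ind (a ∧ b)
    lemma false _     _     = z≤n
    lemma true  false _     = z≤n
    lemma true  true  true  = ≤-refl
    lemma true  true  false = z≤n

  cnt-∩ʳ : ∀ E g h c → cnt E (g ∩ h) c ≤ cnt E h c
  cnt-∩ʳ E g h c = count-mono E λ x → lemma (proj₂ x ≡ᵇ c) (g (proj₁ x)) (h (proj₁ x))
    where
    lemma : ∀ a b d → ind (a ∧ b ∧ d) ≤ ind (a ∧ d)
    lemma false _     _ = z≤n
    lemma true  false _ = z≤n
    lemma true  true  _ = ≤-refl

  cnt-∩-∪ : ∀ E g h c → cnt E (g ∩ h) c + cnt E (g ∪ h) c ≡ cnt E g c + cnt E h c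
  cnt-∩-∪ E g h c = count-modular E λ x → lemma (proj₂ x ≡ᵇ c) (g (proj₁ x)) (h (proj₁ x))
    where
    lemma : ∀ a b d → ind (a ∧ b ∧ d) + ind (a ∧ (b ∨ d)) ≡ ind (a ∧ b) + ind (a ∧ d)
    lemma false _ _ = refl
    lemma true  b d = ind-∩-∪ b d

  -- Uncrossing: `cap` is submodular and `dem` is modular, and `Hall` for the union leaves no slack
  -- for the intersection.
  tight-∩ : ∀ {E g h} → Hall E → Tight E g → Tight E h → Tight E (g ∩ h)
  tight-∩ {E} {g} {h} hE tg th = +-cancelʳ-≤ (cap E (g ∪ h)) _ _ (begin
    cap E (g ∩ h) + cap E (g ∪ h) ≡⟨ Sum-+ m _ _ ⟨
    Sum m (λ c → j ⊓ cnt E (g ∩ h) c + j ⊓ cnt E (g ∪ h) c)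
      ≤⟨ Sum-mono m (λ c _ → ⊓-submodular j (cnt-∩ˡ E g h c) (cnt-∩ʳ E g h c) (cnt-∩-∪ E g h c)) ⟩
    Sum m (λ c → j ⊓ cnt E g c + j ⊓ cnt E h c) ≡⟨ Sum-+ m _ _ ⟩
    cap E g + cap E h             ≤⟨ +-mono-≤ tg th ⟩
    dem g + dem h                 ≡⟨ dem-∩-∪ g h ⟨
    dem (g ∩ h) + dem (g ∪ h)     ≤⟨ +-monoʳ-≤ (dem (g ∩ h)) (hE (g ∪ h)) ⟩
    dem (g ∩ h) + cap E (g ∪ h)   ∎)
    where open ≤-Reasoning

  -- Compare `g` with `g⁻`, which leaves out row `i`. The columns that this row meets are not cut
  -- off at `j` under `g`, so putting the row back raises `cap` by at least its degree, but `dem`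
  -- only by `r i`. Tightness of `g` and `Hall` for `g⁻` then bound the degree.
  blocked⇒deg≤ : ∀ {E g i} → Hall E → Within E → i < n → Tight E g → g i ≡ true →
    (∀ {x} → x ∈ E → proj₁ x ≡ i → cnt E g (proj₂ x) ≤ j) → deg proj₁ i E ≤ r i
  blocked⇒deg≤ {E} {g} {i} hE wE i<n tg gi sat = +-cancelˡ-≤ (cap E g⁻) _ _ (begin
    cap E g⁻ + deg proj₁ i E
      ≡⟨ cong (cap E g⁻ +_) (Sum-count m proj₂ (λ x → proj₁ x ≡ᵇ i) (All.map proj₂ wE)) ⟨
    cap E g⁻ + Sum m inRow                      ≡⟨ Sum-+ m _ _ ⟨
    Sum m (λ c → j ⊓ cnt E g⁻ c + inRow c)      ≤⟨ Sum-mono m (λ c _ → column c) ⟩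
    cap E g                                     ≤⟨ tg ⟩
    dem g                                       ≡⟨ dem-split ⟩
    dem g⁻ + r i                                ≤⟨ +-monoˡ-≤ (r i) (hE g⁻) ⟩
    cap E g⁻ + r i                              ∎)
    where
    open ≤-Reasoning
    g⁻ : ℕ → Bool
    g⁻ k = g k ∧ not (k ≡ᵇ i)

    inRow : ℕ → ℕ
    inRow c = count (λ x → (proj₂ x ≡ᵇ c) ∧ (proj₁ x ≡ᵇ i)) E

    ind-split : ∀ k → ind (g k) ≡ ind (g⁻ k) + ind (k ≡ᵇ i)
    ind-split k with k ≡ᵇ i in eq
    ... | true  rewrite ≡ᵇ⇒≡′ {k} {i} eq | gi = refl
    ... | false with g k
    ...   | true  = refl
    ...   | false = refl

    ≡ᵇ-sym : ∀ a b → (a ≡ᵇ b) ≡ (b ≡ᵇ a)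
    ≡ᵇ-sym zero    zero    = refl
    ≡ᵇ-sym zero    (suc b) = refl
    ≡ᵇ-sym (suc a) zero    = refl
    ≡ᵇ-sym (suc a) (suc b) = ≡ᵇ-sym a b

    dem-split : dem g ≡ dem g⁻ + r i
    dem-split = trans
      (Sum-cong n λ k _ → trans (cong (_* r k) (ind-split k))
        (trans (*-distribʳ-+ (r k) (ind (g⁻ k)) _)
          (cong (λ b → ind (g⁻ k) * r k + ind b * r k) (≡ᵇ-sym k i))))
      (trans (Sum-+ n _ _) (cong (dem g⁻ +_) (Sum-ind n r i<n)))

    cnt-split : ∀ c → cnt E g c ≡ cnt E g⁻ c + inRow c
    cnt-split c = trans (sym (+-identityʳ _)) (trans
      (cong (cnt E g c +_) (sym (count-none E)))
      (count-modular {S = λ x → (proj₂ x ≡ᵇ c) ∧ (proj₁ x ≡ᵇ i)} E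
        λ x → lemma (proj₂ x ≡ᵇ c) (ind-split (proj₁ x))))
      where
      lemma : ∀ a {b d e} → ind b ≡ ind d + ind e → ind (a ∧ b) + 0 ≡ ind (a ∧ d) + ind (a ∧ e)
      lemma true  eq = trans (+-identityʳ _) eq
      lemma false eq = refl

    column : ∀ c → j ⊓ cnt E g⁻ c + inRow c ≤ j ⊓ cnt E g c
    column c with count-witness (λ x → (proj₂ x ≡ᵇ c) ∧ (proj₁ x ≡ᵇ i)) E
    ... | inj₁ eq0 = begin
      j ⊓ cnt E g⁻ c + inRow c ≡⟨ cong (j ⊓ cnt E g⁻ c +_) eq0 ⟩
      j ⊓ cnt E g⁻ c + 0       ≡⟨ +-identityʳ _ ⟩
      j ⊓ cnt E g⁻ c           ≤⟨ ⊓-monoʳ-≤ j (≤-trans (m≤m+n _ (inRow c)) (≤-reflexive (sym (cnt-split c)))) ⟩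
      j ⊓ cnt E g c            ∎
    ... | inj₂ (x , x∈E , px) with eqc , eqi ← ∧-true {proj₂ x ≡ᵇ c} px
                              with refl ← ≡ᵇ⇒≡′ {proj₂ x} eqc = begin
      j ⊓ cnt E g⁻ c + inRow c ≤⟨ +-monoˡ-≤ (inRow c) (m⊓n≤n j _) ⟩
      cnt E g⁻ c + inRow c     ≡⟨ cnt-split c ⟨
      cnt E g c                ≡⟨ m≥n⇒m⊓n≡n (sat x∈E (≡ᵇ⇒≡′ {proj₁ x} eqi)) ⟨
      j ⊓ cnt E g c            ∎

  -- If no cell of row i can be deleted, each is blocked by a tight set; the
  -- intersection of these sets is tight and blocks all of row i at once.
  delete : ∀ {E i} → Hall E → Within E → i < n → r i < deg proj₁ i E →
    ∃₂ λ x E′ → E ↭ x ∷ E′ × Hall E′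
  delete {E} {i} hE wE i<n r<deg with first⊎all E test
    where
    test : ∀ {x} → x ∈ E → (∃₂ λ x E′ → E ↭ x ∷ E′ × Hall E′) ⊎ (proj₁ x ≡ i → ∃ (Blocks E x))
    test {x} x∈E with E′ , p ← ∈⇒↭∷ x∈E with hall? E′ (All.tail (All-resp-↭ p wE))
    ... | inj₁ hE′      = inj₁ (x , E′ , p , hE′)
    ... | inj₂ (g , lt) = inj₂ λ _ → g , blocks hE wE p lt
  ... | inj₁ found   = found
  ... | inj₂ blocked with count-witness (λ x → proj₁ x ≡ᵇ i) E
  ...   | inj₁ eq0 = contradiction (subst (r i <_) eq0 r<deg) λ ()
  ...   | inj₂ (x₀ , x₀∈E , eq) =
    let g , tg , gi , sat = common E blocked
    in contradiction (blocked⇒deg≤ hE wE i<n tg gi sat) (<⇒≱ r<deg)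
    where
    common : ∀ xs → (∀ {x} → x ∈ xs → proj₁ x ≡ i → ∃ (Blocks E x)) →
      ∃ λ g → Tight E g × g i ≡ true × (∀ {x} → x ∈ xs → proj₁ x ≡ i → cnt E g (proj₂ x) ≤ j)
    -- The intersection starts from a set blocking `x₀`, a cell of row `i` that exists because the
    -- degree exceeds `r i`; this puts `i` into the final set.
    common [] _ with x₀≡i ← ≡ᵇ⇒≡′ {proj₁ x₀} eq with g , tg , gx₀ , _ ← blocked x₀∈E x₀≡i =
      g , tg , trans (cong g (sym x₀≡i)) gx₀ , λ ()
    common (x ∷ xs) bl with common xs (bl ∘ there) | proj₁ x ≟ i
    ... | g , tg , gi , sat | no x≢i = g , tg , gi ,
          λ { (here refl) x≡i → contradiction x≡i x≢i ; (there y∈) → sat y∈ }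
    ... | g , tg , gi , sat | yes refl with h , th , hx , satx ← bl (here refl) refl =
          (g ∩ h) , tight-∩ {E} {g} {h} hE tg th , cong₂ _∧_ gi hx ,
          λ { (here refl) _ → ≤-trans (cnt-∩ʳ E g h _) satx
            ; (there y∈) y≡ → ≤-trans (cnt-∩ˡ E g h _) (sat y∈ y≡) }

  -- `s` bounds the length of the list, which each deletion shortens. The deleted cells are kept in
  -- `R`, so that the remaining ones are visibly part of the original list.
  prune : ∀ s E → length E ≤ s → Hall E → Within E →
    ∃₂ λ R E′ → E ↭ R ++ E′ × Hall E′ × (∀ i → i < n → deg proj₁ i E′ ≤ r i)
  prune s E |E|≤s hE wE with any? {n} (λ i → r (toℕ i) <? deg proj₁ (toℕ i) E)
  ... | no  none = [] , E , ↭-refl , hE , λ i i<n → ≮⇒≥ λ lt →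
    none (fromℕ< i<n , subst (λ k → r k < deg proj₁ k E) (sym (toℕ-fromℕ< i<n)) lt)
  ... | yes (i , lt) with x , E′ , p , hE′ ← delete hE wE (toℕ<n i) lt with s
  ...   | zero  = contradiction (subst (_≤ 0) (↭-length p) |E|≤s) λ ()
  ...   | suc s with R , F , q , rest ← prune s E′ (≤-pred (subst (_≤ suc s) (↭-length p) |E|≤s))
                                          hE′ (All.tail (All-resp-↭ p wE)) =
    x ∷ R , F , ↭-trans p (prep x q) , rest

  -- After pruning, `Hall` for the set of all rows bounds `Sum n r` by the sum of the column degrees
  -- cut off at `j`, hence by `length F`. The row degrees bound `length F` by `Sum n r` in turn.
  -- Equality holds throughout, so no column degree exceeds `j`.
  subgraph : ∀ E → (∀ i → r i ≤ j) → Hall E → Within E →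
    ∃₂ λ R F → E ↭ R ++ F × Sum n r ≤ length F ×
      (∀ v → deg proj₁ v F ≤ j) × (∀ v → deg proj₂ v F ≤ j)
  subgraph E r≤j hE wE with R , F , p , hF , degF ← prune (length E) E ≤-refl hE wE
    = R , F , p , size , rows≤ , cols≤
    where
    open ≤-Reasoning
    wF : Within F
    wF = Allₚ.++⁻ʳ R (All-resp-↭ p wE)

    Sum-deg : ∀ k f → All (λ x → f x < k) F → Sum k (λ v → deg f v F) ≡ length F
    Sum-deg k f f<k = trans
      (Sum-cong k λ v _ → count-cong {xs = F} (All.universal (λ x → ∧-identityʳ′ (f x ≡ᵇ v)) F))
      (trans (Sum-count k f (λ _ → true) f<k) (count-all F))

    all≤ : Sum n r ≤ cap F (λ _ → true)
    all≤ = subst (_≤ cap F (λ _ → true)) (Sum-cong n λ i _ → *-identityˡ (r i)) (hF (λ _ → true))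

    cap≡ : cap F (λ _ → true) ≡ Sum m (λ c → j ⊓ deg proj₂ c F)
    cap≡ = Sum-cong m λ c _ → cong (j ⊓_)
      (count-cong {xs = F} (All.universal (λ x → sym (∧-identityʳ′ (proj₂ x ≡ᵇ c))) F))

    size : Sum n r ≤ length F
    size = begin
      Sum n r                        ≤⟨ all≤ ⟩
      cap F (λ _ → true)             ≡⟨ cap≡ ⟩
      Sum m (λ c → j ⊓ deg proj₂ c F) ≤⟨ Sum-mono m (λ c _ → m⊓n≤n j _) ⟩
      Sum m (λ c → deg proj₂ c F)    ≡⟨ Sum-deg m proj₂ (All.map proj₂ wF) ⟩
      length F                       ∎

    rows≤ : ∀ v → deg proj₁ v F ≤ j
    rows≤ v with count-witness (λ x → proj₁ x ≡ᵇ v) F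
    ... | inj₁ eq0 = subst (_≤ j) (sym eq0) z≤n
    ... | inj₂ (x , x∈F , eq) with refl ← ≡ᵇ⇒≡′ {proj₁ x} eq =
      ≤-trans (degF v (proj₁ (All.lookup wF x∈F))) (r≤j v)

    cols≤ : ∀ v → deg proj₂ v F ≤ j
    cols≤ v with count-witness (λ x → proj₂ x ≡ᵇ v) F
    ... | inj₁ eq0 = subst (_≤ j) (sym eq0) z≤n
    ... | inj₂ (x , x∈F , eq) with refl ← ≡ᵇ⇒≡′ {proj₂ x} eq = ≮⇒≥ λ j<deg →
      <-irrefl refl (begin-strict
        Sum n r                         ≤⟨ all≤ ⟩
        cap F (λ _ → true)              ≡⟨ cap≡ ⟩
        Sum m (λ c → j ⊓ deg proj₂ c F)
          <⟨ Sum-mono-< m (λ c → m⊓n≤n j _) v (proj₂ (All.lookup wF x∈F)) (≤-<-trans (m⊓n≤m j _) j<deg) ⟩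
        Sum m (λ c → deg proj₂ c F)     ≡⟨ Sum-deg m proj₂ (All.map proj₂ wF) ⟩
        length F                        ≡⟨ Sum-deg n proj₁ (All.map proj₁ wF) ⟨
        Sum n (λ i → deg proj₁ i F)     ≤⟨ Sum-mono n degF ⟩
        Sum n r                         ∎)

-- Partitions and their Young diagrams

countGe-∷ : ∀ t x xs → countGe (suc t) (x ∷ xs) ≡ ind (t <ᵇ x) + countGe (suc t) xs
countGe-∷ t x xs with suc t ≤? x
... | yes t<x = cong (λ b → ind b + countGe (suc t) xs) (sym (dec-true (suc t ≤? x) t<x))
... | no  t≮x = cong (λ b → ind b + countGe (suc t) xs) (sym (dec-false (suc t ≤? x) t≮x))

Sum-<ᵇ : ∀ k x → Sum k (λ t → ind (t <ᵇ x)) ≡ x ⊓ k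
Sum-<ᵇ zero    x       = sym (⊓-zeroʳ x)
Sum-<ᵇ (suc k) zero    = Sum-0 k
Sum-<ᵇ (suc k) (suc x) = cong suc (Sum-<ᵇ k x)

truncSum : ℕ → List ℕ → ℕ
truncSum k xs = sum (map (_⊓ k) xs)

-- The first `k` columns of a diagram counted by columns and by rows: partial sums of the conjugate
-- are sums of truncated parts.
Sum-countGe : ∀ k xs → Sum k (λ t → countGe (suc t) xs) ≡ truncSum k xs
Sum-countGe k []       = Sum-0 k
Sum-countGe k (x ∷ xs) = trans (Sum-cong k λ t _ → countGe-∷ t x xs)
  (trans (Sum-+ k _ _) (cong₂ _+_ (Sum-<ᵇ k x) (Sum-countGe k xs)))

Sum-last : ∀ k f → Sum (suc k) f ≡ Sum k f + f k
Sum-last zero    f = +-comm (f 0) 0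
Sum-last (suc k) f = trans (cong (f 0 +_) (Sum-last k (f ∘ suc))) (sym (+-assoc (f 0) _ _))

conjSum≡truncSum : ∀ cov k → conjSum cov k ≡ truncSum k (map length cov)
conjSum≡truncSum cov k = trans (conjSum≡Sum k) (Sum-countGe k (map length cov))
  where
  conjSum≡Sum : ∀ k → conjSum cov k ≡ Sum k (λ t → countGe (suc t) (map length cov))
  conjSum≡Sum zero    = refl
  conjSum≡Sum (suc k) = trans (cong (_+ countGe (suc k) (map length cov)) (conjSum≡Sum k))
    (sym (Sum-last k _))

truncSum-id : ∀ {k xs} → All (_≤ k) xs → truncSum k xs ≡ sum xs
truncSum-id []         = refl
truncSum-id (x≤k ∷ ≤k) = cong₂ _+_ (m≤n⇒m⊓n≡m x≤k) (truncSum-id ≤k)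

Sorted : List ℕ → Set
Sorted = AllPairs (λ a b → b ≤ a)

rowLen-≤ : ∀ {b xs} → All (_≤ b) xs → ∀ i → rowLen xs i ≤ b
rowLen-≤ []         i       = z≤n
rowLen-≤ (x≤b ∷ _)  zero    = x≤b
rowLen-≤ (_ ∷ xs≤b) (suc i) = rowLen-≤ xs≤b i

rowLen-antitone : ∀ {p} → Sorted p → ∀ i → rowLen p (suc i) ≤ rowLen p i
rowLen-antitone []         i       = z≤n
rowLen-antitone (≤x ∷ _)   zero    = rowLen-≤ ≤x 0
rowLen-antitone (_ ∷ sp)   (suc i) = rowLen-antitone sp i

rowLen≤head0 : ∀ {p} → Sorted p → ∀ i → rowLen p i ≤ head0 p
rowLen≤head0 []        i       = z≤n
rowLen≤head0 (≤x ∷ _)  zero    = ≤-refl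
rowLen≤head0 (≤x ∷ _)  (suc i) = rowLen-≤ ≤x i

rowLen>0⇒<length : ∀ p i {y} → y < rowLen p i → i < length p
rowLen>0⇒<length (x ∷ p) zero    _ = z<s
rowLen>0⇒<length (x ∷ p) (suc i) y< = s<s (rowLen>0⇒<length p i y<)

sum-take-suc : ∀ p k → sum (take (suc k) p) ≡ sum (take k p) + rowLen p k
sum-take-suc []      zero    = refl
sum-take-suc []      (suc k) = refl
sum-take-suc (x ∷ p) zero    = +-comm x 0
sum-take-suc (x ∷ p) (suc k) = trans (cong (x +_) (sum-take-suc p k)) (sym (+-assoc x _ _))

countGe-antitone : ∀ t xs → countGe (suc t) xs ≤ countGe t xs
countGe-antitone t [] = z≤n
countGe-antitone t (x ∷ xs) with suc t ≤? x | t ≤? x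
... | yes _   | yes _   = s≤s (countGe-antitone t xs)
... | yes t<x | no  t≰x = contradiction (<⇒≤ t<x) t≰x
... | no  _   | yes _   = m≤n⇒m≤1+n (countGe-antitone t xs)
... | no  _   | no  _   = countGe-antitone t xs

-- Both inequalities say that the cell `(i , j)` lies in the diagram; with the converse below this
-- gives the conjugacy.
rowLen⇒countGe : ∀ {p} → Sorted p → ∀ i j → suc j ≤ rowLen p i → suc i ≤ countGe (suc j) p
rowLen⇒countGe {x ∷ p} (≤x ∷ sp) i j j< with suc j ≤? x
rowLen⇒countGe {x ∷ p} (≤x ∷ sp) zero    j j< | yes _   = s≤s z≤n
rowLen⇒countGe {x ∷ p} (≤x ∷ sp) (suc i) j j< | yes _   = s≤s (rowLen⇒countGe sp i j j<)
rowLen⇒countGe {x ∷ p} (≤x ∷ sp) i       j j< | no  j≮x =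
  contradiction (≤-trans j< (rowLen≤head0 (≤x ∷ sp) i)) j≮x

countGe⇒rowLen : ∀ {p} → Sorted p → ∀ i j → suc i ≤ countGe (suc j) p → suc j ≤ rowLen p i
countGe⇒rowLen {x ∷ p} (≤x ∷ sp) i j i< with suc j ≤? x
countGe⇒rowLen {x ∷ p} (≤x ∷ sp) zero    j i<       | yes j<x = j<x
countGe⇒rowLen {x ∷ p} (≤x ∷ sp) (suc i) j (s≤s i<) | yes _   = countGe⇒rowLen sp i j i<
countGe⇒rowLen {x ∷ p} (≤x ∷ sp) i       j i<       | no  j≮x =
  contradiction (≤-trans (countGe⇒rowLen sp i j i<) (rowLen-≤ ≤x i)) j≮x

-- Truncation at `rowLen p k` cuts each of the first `k` rows down to that length and leaves the
-- later rows alone; with at most `k` rows the length is 0. This will bound the number of cells that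
-- the matchings miss.
sum+rowLen*k≤ : ∀ {p} → Sorted p → ∀ k →
  sum p + k * rowLen p k ≤ sum (take k p) + truncSum (rowLen p k) p
sum+rowLen*k≤ []                    k       =
  ≤-trans (≤-reflexive (*-zeroʳ k)) z≤n
sum+rowLen*k≤ {x ∷ p} (≤x ∷ sp) zero    = ≤-reflexive
  (trans (+-identityʳ (x + sum p)) (sym (truncSum-id (≤-refl ∷ ≤x))))
sum+rowLen*k≤ {x ∷ p} (≤x ∷ sp) (suc k) = begin
  (x + sum p) + (l + k * l)                 ≡⟨ +-interchange x (sum p) l (k * l) ⟩
  (x + l) + (sum p + k * l)                 ≤⟨ +-monoʳ-≤ (x + l) (sum+rowLen*k≤ sp k) ⟩
  (x + l) + (sum (take k p) + truncSum l p) ≡⟨ +-interchange x l _ _ ⟩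
  (x + sum (take k p)) + (l + truncSum l p) ≡⟨ cong (λ a → (x + sum (take k p)) + (a + truncSum l p))
                                                   (m≥n⇒m⊓n≡n (rowLen-≤ ≤x k)) ⟨
  (x + sum (take k p)) + (x ⊓ l + truncSum l p) ∎
  where
  open ≤-Reasoning
  l = rowLen p k

row : ℕ → ℕ → List Cell
row i x = map (i ,_) (upTo x)

∈-rowsFrom⁻ : ∀ k p {i y} → (i , y) ∈ concat (rowsFrom k p) → ∃ λ i′ → i ≡ k + i′ × y < rowLen p i′
∈-rowsFrom⁻ k (x ∷ p) c∈ with ∈-++⁻ (row k x) c∈
... | inj₁ c∈row with _ , y∈ , refl ← ∈-map⁻ (k ,_) c∈row = 0 , sym (+-identityʳ k) , ∈-upTo⁻ y∈
... | inj₂ c∈rest with i′ , eq , y< ← ∈-rowsFrom⁻ (suc k) p c∈rest =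
  suc i′ , trans eq (sym (+-suc k i′)) , y<

∈-rowsFrom⁺ : ∀ k p i {y} → y < rowLen p i → (k + i , y) ∈ concat (rowsFrom k p)
∈-rowsFrom⁺ k (x ∷ p) zero    y< rewrite +-identityʳ k = ∈-++⁺ˡ (∈-map⁺ (k ,_) (∈-upTo⁺ y<))
∈-rowsFrom⁺ k (x ∷ p) (suc i) y< rewrite +-suc k i     = ∈-++⁺ʳ (row k x) (∈-rowsFrom⁺ (suc k) p i y<)

∈-rows⇔InDiag : ∀ p c → (c ∈ concat (rows p)) ⇔ InDiag p c
∈-rows⇔InDiag p (i , y) = mk⇔ to (∈-rowsFrom⁺ 0 p i)
  where
  to : (i , y) ∈ concat (rows p) → y < rowLen p i
  to c∈ with _ , refl , y< ← ∈-rowsFrom⁻ 0 p c∈ = y<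

unique-rowsFrom : ∀ k p → Unique (concat (rowsFrom k p))
unique-rowsFrom k []      = []
unique-rowsFrom k (x ∷ p) = Uniqueₚ.++⁺ (Uniqueₚ.map⁺ (cong proj₂) (Uniqueₚ.upTo⁺ x))
  (unique-rowsFrom (suc k) p) disjoint
  where
  disjoint : Disjoint (row k x) (concat (rowsFrom (suc k) p))
  disjoint (c∈row , c∈rest) with _ , _ , refl ← ∈-map⁻ (k ,_) c∈row
    with i′ , eq , _ ← ∈-rowsFrom⁻ (suc k) p c∈rest = m≢1+m+n k eq

map-length-rowsFrom : ∀ k p → map length (rowsFrom k p) ≡ p
map-length-rowsFrom k []      = refl
map-length-rowsFrom k (x ∷ p) = cong₂ _∷_ (trans (length-map (k ,_) (upTo x)) (length-upTo x))
  (map-length-rowsFrom (suc k) p)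

length-concat-rowsFrom : ∀ k p → length (concat (rowsFrom k p)) ≡ sum p
length-concat-rowsFrom k []      = refl
length-concat-rowsFrom k (x ∷ p) = trans (length-++ (row k x))
  (cong₂ _+_ (trans (length-map (k ,_) (upTo x)) (length-upTo x)) (length-concat-rowsFrom (suc k) p))

-- Wideness gives the min-cut condition

sel : (ℕ → Bool) → List ℕ → List ℕ
sel g []       = []
sel g (x ∷ xs) = if g 0 then x ∷ sel (g ∘ suc) xs else sel (g ∘ suc) xs

sel-⊆ : ∀ g p → sel g p ⊆ p
sel-⊆ g []      = []
sel-⊆ g (x ∷ p) with g 0
... | true  = refl ∷ sel-⊆ (g ∘ suc) p
... | false = x ∷ʳ sel-⊆ (g ∘ suc) p

sel≤head0 : ∀ g {p} → Sorted p → All (_≤ head0 (sel g p)) (sel g p)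
sel≤head0 g []              = []
sel≤head0 g {x ∷ p} (≤x ∷ sp) with g 0
... | true  = ≤-refl ∷ All-resp-⊆ (sel-⊆ (g ∘ suc) p) ≤x
... | false = sel≤head0 (g ∘ suc) sp

Sum-sel : ∀ j g p → Sum (length p) (λ i → ind (g i) * (rowLen p i ⊓ j)) ≡ truncSum j (sel g p)
Sum-sel j g []      = refl
Sum-sel j g (x ∷ p) with g 0
... | true  = cong₂ _+_ (+-identityʳ (x ⊓ j)) (Sum-sel j (g ∘ suc) p)
... | false = Sum-sel j (g ∘ suc) p

count-applyUpTo : ∀ {A : Set} (P : A → Bool) (f : ℕ → A) (h : ℕ → ℕ) x →
  count P (map f (applyUpTo h x)) ≡ Sum x (λ t → ind (P (f (h t))))
count-applyUpTo P f h zero    = refl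
count-applyUpTo P f h (suc x) = cong (ind (P (f (h 0))) +_) (count-applyUpTo P f (h ∘ suc) x)

Sum-≡ᵇ-∧ : ∀ x c b → Sum x (λ t → ind ((t ≡ᵇ c) ∧ b)) ≡ ind ((c <ᵇ x) ∧ b)
Sum-≡ᵇ-∧ zero    c       b = refl
Sum-≡ᵇ-∧ (suc x) zero    b = trans (cong (ind b +_) (Sum-0 x)) (+-identityʳ (ind b))
Sum-≡ᵇ-∧ (suc x) (suc c) b = Sum-≡ᵇ-∧ x c b

-- Column `c` meets exactly the rows longer than `c`. There are two predicates because cells carry
-- absolute row indices, read by `g`, whereas `sel` renumbers the remaining rows from 0, which `h`
-- follows.
count-rowsFrom : ∀ k p (g h : ℕ → Bool) c → (∀ i → h i ≡ g (k + i)) →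
  count (λ x → (proj₂ x ≡ᵇ c) ∧ g (proj₁ x)) (concat (rowsFrom k p)) ≡ countGe (suc c) (sel h p)
count-rowsFrom k []      g h c eq = refl
count-rowsFrom k (x ∷ p) g h c eq = trans (count-++ P (row k x) _)
  (trans (cong₂ _+_ (trans (count-applyUpTo P (k ,_) id x) (Sum-≡ᵇ-∧ x c (g k)))
      (count-rowsFrom (suc k) p g (h ∘ suc) c λ i → trans (eq (suc i)) (cong g (+-suc k i))))
    (join (g k) (trans (eq 0) (cong g (+-identityʳ k)))))
  where
  P : Cell → Bool
  P x = (proj₂ x ≡ᵇ c) ∧ g (proj₁ x)

  join : ∀ b → h 0 ≡ b → ind ((c <ᵇ x) ∧ b) + countGe (suc c) (sel (h ∘ suc) p)
         ≡ countGe (suc c) (sel h (x ∷ p))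
  join true  h0 rewrite h0 = trans (cong (λ b → ind b + _) (sym (∧-identityʳ′ (c <ᵇ x))))
    (sym (countGe-∷ c x (sel (h ∘ suc) p)))
  join false h0 rewrite h0 with c <ᵇ x
  ... | true  = refl
  ... | false = refl

sum-take-applyUpTo : ∀ (F : ℕ → ℕ) f j h → sum (take j (map F (applyUpTo f h))) ≡ Sum (j ⊓ h) (F ∘ f)
sum-take-applyUpTo F f zero    h       = refl
sum-take-applyUpTo F f (suc j) zero    = refl
sum-take-applyUpTo F f (suc j) (suc h) = cong (F (f 0) +_) (sum-take-applyUpTo F (f ∘ suc) j h)

Sum-⊓ : ∀ j h F → (∀ t → h ≤ t → F t ≡ 0) → Sum j F ≡ Sum (j ⊓ h) F
Sum-⊓ zero    h       F F0 = refl
Sum-⊓ (suc j) zero    F F0 = trans (Sum-cong (suc j) λ t _ → F0 t z≤n) (Sum-0 j)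
Sum-⊓ (suc j) (suc h) F F0 = cong (F 0 +_) (Sum-⊓ j h (F ∘ suc) λ t h≤t → F0 (suc t) (s≤s h≤t))

countGe-above : ∀ {b xs} → All (_≤ b) xs → ∀ t → b ≤ t → countGe (suc t) xs ≡ 0
countGe-above []               t b≤t = refl
countGe-above {xs = x ∷ _} (x≤b ∷ ≤b) t b≤t with suc t ≤? x
... | yes t<x = contradiction t<x (≤⇒≯ (≤-trans x≤b b≤t))
... | no  _   = countGe-above ≤b t b≤t

-- `conj μ` stops at `head0 μ`, and column counts vanish from there on because `head0 μ` bounds all
-- parts, so its length does not affect the sum.
sum-take-conj : ∀ j {μ} → All (_≤ head0 μ) μ → sum (take j (conj μ)) ≡ truncSum j μ
sum-take-conj j {μ} μ≤ = trans (sum-take-applyUpTo _ id j (head0 μ))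
  (trans (sym (Sum-⊓ j (head0 μ) _ (countGe-above μ≤))) (Sum-countGe j μ))

countGe-take : ∀ t j μ → countGe t (take j μ) ≤ j ⊓ countGe t μ
countGe-take t zero    μ  = z≤n
countGe-take t (suc j) [] = z≤n
countGe-take t (suc j) (x ∷ μ) with t ≤? x
... | yes _ = s≤s (countGe-take t j μ)
... | no  _ = ≤-trans (countGe-take t j μ) (⊓-monoˡ-≤ (countGe t μ) (n≤1+n j))

-- Count the first `j` rows by columns: a column meets at most `j` of them, and no more than it
-- meets in all of `μ`.
sum-take≤ : ∀ j m {μ} → All (_≤ m) μ → sum (take j μ) ≤ Sum m (λ c → j ⊓ countGe (suc c) μ)
sum-take≤ j m {μ} μ≤m = begin
  sum (take j μ)                           ≡⟨ truncSum-id (Allₚ.take⁺ j μ≤m) ⟨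
  truncSum m (take j μ)                    ≡⟨ Sum-countGe m (take j μ) ⟨
  Sum m (λ c → countGe (suc c) (take j μ)) ≤⟨ Sum-mono m (λ c _ → countGe-take (suc c) j μ) ⟩
  Sum m (λ c → j ⊓ countGe (suc c) μ)      ∎
  where open ≤-Reasoning

module _ (p : List ℕ) (sp : Sorted p) (wide : Wide p) (j : ℕ) where

  open Deletion (length p) (head0 p) j (λ i → rowLen p i ⊓ j)

  -- For the subpartition `μ` of the selected rows, the demand is the sum of the first `j` parts of
  -- `conj μ`, and the capacity is at least the sum of the first `j` parts of `μ`. Wideness compares
  -- the two.
  wide⇒Hall : Hall (concat (rows p))
  wide⇒Hall g = begin
    dem g                   ≡⟨ Sum-sel j g p ⟩
    truncSum j μ            ≡⟨ sum-take-conj j (sel≤head0 g sp) ⟨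
    sum (take j (conj μ))   ≤⟨ wide μ (sel-⊆ g p) j ⟩
    sum (take j μ)          ≤⟨ sum-take≤ j (head0 p) (All-resp-⊆ (sel-⊆ g p) (≤head0 sp)) ⟩
    Sum (head0 p) (λ c → j ⊓ countGe (suc c) μ)
      ≡⟨ Sum-cong (head0 p) (λ c _ → cong (j ⊓_) (count-rowsFrom 0 p g g c (λ _ → refl))) ⟨
    cap (concat (rows p)) g ∎
    where
    open ≤-Reasoning
    μ = sel g p

    ≤head0 : ∀ {p} → Sorted p → All (_≤ head0 p) p
    ≤head0 []        = []
    ≤head0 (≤x ∷ _)  = ≤-refl ∷ ≤x

  rows-Within : Within (concat (rows p))
  rows-Within = All.tabulate λ {x} x∈ →
    let x∈p = Equivalence.to (∈-rows⇔InDiag p x) x∈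
    in rowLen>0⇒<length p (proj₁ x) x∈p , <-≤-trans x∈p (rowLen≤head0 sp (proj₁ x))

  -- Abstract so that case analysis on it does not run the deletion procedure.
  abstract
    wide⇒matchings : ∃ λ css → length css ≡ j × All Matching css × Unique (concat css) ×
      All (InDiag p) (concat css) × truncSum j p ≤ length (concat css)
    wide⇒matchings
      with R , F , q , size , degr , degc ←
        subgraph (concat (rows p)) (λ i → m⊓n≤n (rowLen p i) j) wide⇒Hall rows-Within
      with css , len , ms , q′ ← könig j F degr degc
      = css , len , ms ,
        Unique-resp-↭ (↭-sym q′) (subst Unique drop-R (Uniqueₚ.drop⁺ (length R)
          (Unique-resp-↭ q (unique-rowsFrom 0 p)))) ,
        All-resp-↭ (↭-sym q′) (Allₚ.++⁻ʳ R (All-resp-↭ q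
          (All.tabulate λ {x} → Equivalence.to (∈-rows⇔InDiag p x)))) ,
        subst (truncSum j p ≤_) (sym (↭-length q′)) (subst (_≤ length F) Sum≡ size)
      where
      drop-R : drop (length R) (R ++ F) ≡ F
      drop-R = drop-length-++ R
        where
        drop-length-++ : ∀ (xs : List Cell) {ys} → drop (length xs) (xs ++ ys) ≡ ys
        drop-length-++ []       = refl
        drop-length-++ (_ ∷ xs) = drop-length-++ xs

      Sum≡ : Sum (length p) (λ i → rowLen p i ⊓ j) ≡ truncSum j p
      Sum≡ = Sum-rowLen p
        where
        Sum-rowLen : ∀ p → Sum (length p) (λ i → rowLen p i ⊓ j) ≡ truncSum j p
        Sum-rowLen []      = refl
        Sum-rowLen (x ∷ p) = cong (x ⊓ j +_) (Sum-rowLen p)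

-- Weak duality: a clique and a stable set share at most one cell

open DecMembership (≡-dec _≟_ _≟_) using (_∈?_)

length-filter-split : ∀ {A : Set} {P : A → Set} (P? : ∀ x → Dec (P x)) xs →
  length xs ≡ length (filter P? xs) + length (filter (¬? ∘ P?) xs)
length-filter-split P? []       = refl
length-filter-split P? (x ∷ xs) with P? x
... | yes _ = cong suc (length-filter-split P? xs)
... | no  _ = trans (cong suc (length-filter-split P? xs)) (sym (+-suc _ _))

ShareAtMostOne : List Cell → List Cell → Set
ShareAtMostOne C D = ∀ {x y} → x ∈ C → y ∈ C → x ∈ D → y ∈ D → x ≡ y

-- The first block accounts for at most one element of `S`; the elements outside it are covered by
-- the other blocks.
unique-length≤ : ∀ {S} Cs → Unique S → (∀ {x} → x ∈ S → Any (x ∈_) Cs) →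
  (∀ {C} → C ∈ Cs → ShareAtMostOne C S) → length S ≤ length Cs
unique-length≤ {[]}    []       uS cov share = z≤n
unique-length≤ {x ∷ _} []       uS cov share with () ← cov (here refl)
unique-length≤ {S}     (C ∷ Cs) uS cov share = begin
  length S                                ≡⟨ length-filter-split (_∈? C) S ⟩
  length inC + length outC                ≤⟨ +-mono-≤ inC≤1 outC≤ ⟩
  suc (length Cs)                         ∎
  where
  open ≤-Reasoning
  inC  = filter (_∈? C) S
  outC = filter (¬? ∘ (_∈? C)) S

  all-equal⇒length≤1 : ∀ {T : List Cell} → Unique T → (∀ {x y} → x ∈ T → y ∈ T → x ≡ y) → length T ≤ 1
  all-equal⇒length≤1 {[]}        _                eq = z≤n
  all-equal⇒length≤1 {_ ∷ []}    _                eq = s≤s z≤n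
  all-equal⇒length≤1 {_ ∷ _ ∷ _} ((x≢y ∷ _) ∷ _)  eq =
    contradiction (eq (here refl) (there (here refl))) x≢y

  inC≤1 : length inC ≤ 1
  inC≤1 = all-equal⇒length≤1 (Uniqueₚ.filter⁺ (_∈? C) uS) λ x∈ y∈ →
    let x∈S , x∈C = ∈-filter⁻ (_∈? C) x∈
        y∈S , y∈C = ∈-filter⁻ (_∈? C) y∈
    in share (here refl) x∈C y∈C x∈S y∈S

  out⊆ : ∀ {x} → x ∈ outC → x ∈ S × x ∉ C
  out⊆ = ∈-filter⁻ (¬? ∘ (_∈? C)) {xs = S}

  outC≤ : length outC ≤ length Cs
  outC≤ = unique-length≤ Cs (Uniqueₚ.filter⁺ (¬? ∘ (_∈? C)) uS)
    (λ x∈ → Any.tail (proj₂ (out⊆ x∈)) (cov (proj₁ (out⊆ x∈))))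
    (λ D∈ x∈D y∈D x∈ y∈ → share (there D∈) x∈D y∈D (proj₁ (out⊆ x∈)) (proj₁ (out⊆ y∈)))

unique-⊆⇒length≤ : ∀ {S} D → Unique S → (∀ {x} → x ∈ S → x ∈ D) → length S ≤ length D
unique-⊆⇒length≤ D uS S⊆D = subst (_ ≤_) (length-map [_] D)
  (unique-length≤ (map [_] D) uS (λ x∈ → Anyₚ.map⁺ (Any.map here (S⊆D x∈))) share)
  where
  share : ∀ {C} → C ∈ map [_] D → ShareAtMostOne C _
  share C∈ x∈C y∈C _ _ with _ , _ , refl ← ∈-map⁻ [_] C∈ with here refl ← x∈C | here refl ← y∈C = refl

-- A block `D` of the cover holds at most `length D` elements of `S`, and at most one from each
-- block of `Cs`, hence at most the smaller of the two numbers.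
weak-duality : ∀ {S} Cs cov → Unique S → (∀ {x} → x ∈ S → Any (x ∈_) Cs) →
  (∀ {x} → x ∈ S → x ∈ concat cov) → (∀ {C D} → C ∈ Cs → D ∈ cov → ShareAtMostOne C D) →
  length S ≤ truncSum (length Cs) (map length cov)
weak-duality {[]}    Cs []        uS inCs incov share = z≤n
weak-duality {_ ∷ _} Cs []        uS inCs incov share with () ← incov (here refl)
weak-duality {S}     Cs (D ∷ cov) uS inCs incov share = begin
  length S                 ≡⟨ length-filter-split (_∈? D) S ⟩
  length inD + length outD ≤⟨ +-mono-≤ (⊓-glb inD≤D inD≤Cs) outD≤ ⟩
  truncSum (length Cs) (map length (D ∷ cov)) ∎
  where
  open ≤-Reasoning
  inD  = filter (_∈? D) S
  outD = filter (¬? ∘ (_∈? D)) S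

  in⊆ : ∀ {x} → x ∈ inD → x ∈ S × x ∈ D
  in⊆ = ∈-filter⁻ (_∈? D) {xs = S}

  out⊆ : ∀ {x} → x ∈ outD → x ∈ S × x ∉ D
  out⊆ = ∈-filter⁻ (¬? ∘ (_∈? D)) {xs = S}

  inD≤D : length inD ≤ length D
  inD≤D = unique-⊆⇒length≤ D (Uniqueₚ.filter⁺ (_∈? D) uS) (proj₂ ∘ in⊆)

  inD≤Cs : length inD ≤ length Cs
  inD≤Cs = unique-length≤ Cs (Uniqueₚ.filter⁺ (_∈? D) uS) (inCs ∘ proj₁ ∘ in⊆)
    λ C∈ x∈C y∈C x∈ y∈ → share C∈ (here refl) x∈C y∈C (proj₂ (in⊆ x∈)) (proj₂ (in⊆ y∈))

  outD≤ : length outD ≤ truncSum (length Cs) (map length cov)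
  outD≤ = weak-duality Cs cov (Uniqueₚ.filter⁺ (¬? ∘ (_∈? D)) uS) (inCs ∘ proj₁ ∘ out⊆)
    (λ x∈ → [ (λ x∈D → contradiction x∈D (proj₂ (out⊆ x∈))) , id ]′
              (∈-++⁻ D (incov (proj₁ (out⊆ x∈)))))
    (λ C∈ D∈ → share C∈ (there D∈))

clique-stable-share : ∀ p {C D} → IsClique p C → IsStable p D → ShareAtMostOne C D
clique-stable-share p (_ , adj) (_ , nonadj) {x} {y} x∈C y∈C x∈D y∈D with ≡-dec _≟_ _≟_ x y
... | yes x≡y = x≡y
... | no  x≢y = contradiction (adj x∈C y∈C x≢y) (nonadj x∈D y∈D)

-- Stated for two abstract kinds of block, so that cliques against a stable set cover and stable
-- sets against a clique cover are both instances.
union≤conjSum : ∀ p {P Q k S cov} → (∀ {C D} → P C → Q D → ShareAtMostOne C D) →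
  (∀ {C} → P C → All (InDiag p) C) → UnionOf P k S → IsCover p Q cov → length S ≤ conjSum cov k
union≤conjSum p {P} {Q} {k} {S} {cov} share inP (uS , Cs , allP , S⇔) (allQ , _ , cov⇔) =
  subst (length S ≤_)
    (trans (cong (λ l → truncSum l (map length cov)) (length-toList Cs)) (sym (conjSum≡truncSum cov k)))
    (weak-duality (toList Cs) cov uS (λ {x} → Equivalence.to (S⇔ x))
      (λ {x} x∈S → Equivalence.from (cov⇔ x) (diag (Equivalence.to (S⇔ x) x∈S)))
      (λ C∈ D∈ → share (All.lookup allP C∈) (proj₁ (All.lookup allQ D∈))))
  where
  diag : ∀ {x} → Any (x ∈_) (toList Cs) → InDiag p x
  diag x∈ = let pC , x∈C = All.lookupAny allP x∈ in All.lookup (inP pC) x∈C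

kstable≤conjSum : ∀ p {k S cov} → KStable p k S → IsCliqueCover p cov → length S ≤ conjSum cov k
kstable≤conjSum p = union≤conjSum p
  (λ st cl x∈C y∈C x∈D y∈D → clique-stable-share p cl st x∈D y∈D x∈C y∈C) proj₁

kclique≤conjSum : ∀ p {k S cov} → KClique p k S → IsStableCover p cov → length S ≤ conjSum cov k
kclique≤conjSum p = union≤conjSum p (clique-stable-share p) proj₁

concat-UnionOf : ∀ {P k} css → length css ≡ k → All P css → Unique (concat css) → UnionOf P k (concat css)
concat-UnionOf {P} css refl allP u =
  u , fromList css , subst (All P) (sym list≡) allP ,
  λ x → subst (λ l → (x ∈ concat css) ⇔ Any (x ∈_) l) (sym list≡) (mk⇔ (∈-concat⁻ css) ∈-concat⁺)
  where
  list≡ = toList∘fromList css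

-- Saturation

matching⇒stable : ∀ p {C} → All (InDiag p) C → Matching C → IsStable p C
matching⇒stable p inC mC = inC , λ x∈ y∈ (x≢y , adj) → case-adj (apart mC x∈ y∈ x≢y) adj
  where
  apart : ∀ {C x y} → Matching C → x ∈ C → y ∈ C → x ≢ y → Apart x y
  apart (x#  ∷ _) (here refl) (here refl) x≢y = contradiction refl x≢y
  apart (x#  ∷ _) (here refl) (there y∈)  x≢y = All.lookup x# y∈
  apart (x#  ∷ _) (there x∈)  (here refl) x≢y = Apart-sym (All.lookup x# x∈)
  apart (_   ∷ m) (there x∈)  (there y∈)  x≢y = apart m x∈ y∈ x≢y

  case-adj : ∀ {x y : Cell} → Apart x y → ¬ (proj₁ x ≡ proj₁ y ⊎ proj₂ x ≡ proj₂ y)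
  case-adj (r≢ , c≢) (inj₁ eq) = r≢ eq
  case-adj (r≢ , c≢) (inj₂ eq) = c≢ eq

matchings⇒stables : ∀ p {css} → All Matching css → All (InDiag p) (concat css) → All (IsStable p) css
matchings⇒stables p ms inD = All.zipWith (λ (inC , mC) → matching⇒stable p inC mC) (Allₚ.concat⁻ inD , ms)

rows-cliques : ∀ p → All (IsClique p) (rows p)
rows-cliques p = All.tabulate λ C∈ →
  All.tabulate (λ {x} x∈C → Equivalence.to (∈-rows⇔InDiag p x) (∈-concat⁺′ x∈C C∈)) ,
  λ x∈ y∈ x≢y → x≢y , inj₁ (same-row 0 p C∈ x∈ y∈)
  where
  same-row : ∀ k p {C x y} → C ∈ rowsFrom k p → x ∈ C → y ∈ C → proj₁ x ≡ proj₁ y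
  same-row k (l ∷ p) (here refl) x∈ y∈
    with _ , _ , refl ← ∈-map⁻ (k ,_) x∈ | _ , _ , refl ← ∈-map⁻ (k ,_) y∈ = refl
  same-row k (l ∷ p) (there C∈)  x∈ y∈ = same-row (suc k) p C∈ x∈ y∈

rows-cover : ∀ p → All (1 ≤_) p → IsCliqueCover p (rows p)
rows-cover p pos = All.zip (rows-cliques p , nonempty 0 pos) , unique-rowsFrom 0 p , ∈-rows⇔InDiag p
  where
  nonempty : ∀ k {p} → All (1 ≤_) p → All (_≢ []) (rowsFrom k p)
  nonempty k []                  = []
  nonempty k {suc _ ∷ _} (_ ∷ pos) = (λ ()) ∷ nonempty (suc k) pos

conjSum-rows : ∀ p k → conjSum (rows p) k ≡ truncSum k p
conjSum-rows p k = trans (conjSum≡truncSum (rows p) k) (cong (truncSum k) (map-length-rowsFrom 0 p))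

-- A `k`-clique is given by exactly `k` blocks, so empty cliques fill the gap when there are fewer
-- than `k` rows.
takePad : ℕ → List (List Cell) → List (List Cell)
takePad zero    css        = []
takePad (suc k) []         = [] ∷ takePad k []
takePad (suc k) (cs ∷ css) = cs ∷ takePad k css

length-takePad : ∀ k css → length (takePad k css) ≡ k
length-takePad zero    css       = refl
length-takePad (suc k) []        = cong suc (length-takePad k [])
length-takePad (suc k) (_ ∷ css) = cong suc (length-takePad k css)

All-takePad : ∀ {P : List Cell → Set} → P [] → ∀ k {css} → All P css → All P (takePad k css)
All-takePad p[] zero    _          = []
All-takePad p[] (suc k) []         = p[] ∷ All-takePad p[] k []
All-takePad p[] (suc k) (pc ∷ pcs) = pc ∷ All-takePad p[] k pcs

concat-takePad-rows : ∀ k i p → concat (takePad k (rowsFrom i p)) ≡ concat (rowsFrom i (take k p))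
concat-takePad-rows zero    i p       = refl
concat-takePad-rows (suc k) i []      = trans (concat-takePad-rows k i []) (cong (concat ∘ rowsFrom i) (take-[] k))
concat-takePad-rows (suc k) i (x ∷ p) = cong (row i x ++_) (concat-takePad-rows k (suc i) p)

top-rows-KClique : ∀ p k → ∃ λ S → KClique p k S × length S ≡ sum (take k p)
top-rows-KClique p k = concat blocks ,
  concat-UnionOf blocks (length-takePad k (rows p)) (All-takePad ([] , λ ()) k (rows-cliques p))
    (subst Unique (sym concat≡) (unique-rowsFrom 0 (take k p))) ,
  trans (cong length concat≡) (length-concat-rowsFrom 0 (take k p))
  where
  blocks  = takePad k (rows p)
  concat≡ = concat-takePad-rows k 0 p

truncSum-++ : ∀ k xs ys → truncSum k (xs ++ ys) ≡ truncSum k xs + truncSum k ys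
truncSum-++ k xs ys = trans (cong sum (map-++ (_⊓ k) xs ys)) (sum-++ (map (_⊓ k) xs) _)

truncSum≤length* : ∀ k xs → truncSum k xs ≤ length xs * k
truncSum≤length* k []       = z≤n
truncSum≤length* k (x ∷ xs) = +-mono-≤ (m⊓n≤n x k) (truncSum≤length* k xs)

truncSum-singletons : ∀ {A : Set} k (xs : List A) → truncSum k (map length (map [_] xs)) ≤ length xs
truncSum-singletons k []       = z≤n
truncSum-singletons k (x ∷ xs) = +-mono-≤ (m⊓n≤m 1 k) (truncSum-singletons k xs)

-- A cover admits no empty block, but some of the matchings may be empty and have to be dropped.
nonempty? : ∀ (C : List Cell) → Dec (C ≢ [])
nonempty? []      = no λ ne → ne refl
nonempty? (_ ∷ _) = yes λ ()

concat-filter-nonempty : ∀ css → concat (filter nonempty? css) ≡ concat css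
concat-filter-nonempty []              = refl
concat-filter-nonempty ([] ∷ css)      = concat-filter-nonempty css
concat-filter-nonempty ((x ∷ C) ∷ css) = cong ((x ∷ C) ++_) (concat-filter-nonempty css)

-- Saturated covers, Δ-conjugacy and the t-phenomenon

module _ (p : List ℕ) (pos : All (1 ≤_) p) (sp : Sorted p) (wide : Wide p) where

  -- The `k` matchings form a `k`-stable set that attains the weak duality bound given by the rows.
  rows-saturated : ∀ k → KSatClique p (rows p) k
  rows-saturated k with css , len , ms , u , inD , size ← wide⇒matchings p sp wide k
    with kst ← concat-UnionOf css len (matchings⇒stables p ms inD) u =
    (concat css , kst , ≤-antisym (upper _ kst) (subst (_≤ length (concat css)) (sym (conjSum-rows p k)) size)) ,
    upper
    where
    upper : ∀ S → KStable p k S → length S ≤ conjSum (rows p) k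
    upper S kS = kstable≤conjSum p kS (rows-cover p pos)

  -- With j = λ_{k+1}: j disjoint matchings leave uncovered only cells of the
  -- first k rows, which become singletons.
  stable-cover : ∀ k → ∃ λ cov → IsStableCover p cov ×
    (∀ l → truncSum l (map length cov) + k * rowLen p k ≤ rowLen p k * l + sum (take k p))
  stable-cover k with css , len , ms , u , inD , size ← wide⇒matchings p sp wide (rowLen p k) =
    cov , (blocks , subst Unique (sym concat-cov) unique , cov⇔) , bound
    where
    j         = rowLen p k
    cells     = concat (rows p)
    uncovered = filter (¬? ∘ (_∈? concat css)) cells
    cov       = filter nonempty? css ++ map [_] uncovered

    uncovered⊆ : ∀ {x} → x ∈ uncovered → x ∈ cells × x ∉ concat css
    uncovered⊆ = ∈-filter⁻ (¬? ∘ (_∈? concat css)) {xs = cells}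

    concat-cov : concat cov ≡ concat css ++ uncovered
    concat-cov = trans (sym (concat-++ (filter nonempty? css) _))
      (cong₂ _++_ (concat-filter-nonempty css) concat-map-[ uncovered ])

    unique : Unique (concat css ++ uncovered)
    unique = Uniqueₚ.++⁺ u (Uniqueₚ.filter⁺ _ (unique-rowsFrom 0 p))
      λ (x∈css , x∈unc) → proj₂ (uncovered⊆ x∈unc) x∈css

    blocks : All (λ C → IsStable p C × C ≢ []) cov
    blocks = Allₚ.++⁺
      (All.zip (Allₚ.filter⁺ nonempty? (matchings⇒stables p ms inD) , Allₚ.all-filter nonempty? css))
      (Allₚ.map⁺ (All.tabulate λ {x} x∈ →
        matching⇒stable p (Equivalence.to (∈-rows⇔InDiag p x) (proj₁ (uncovered⊆ x∈)) ∷ []) ([] ∷ []) , λ ()))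

    cov⇔ : ∀ c → (c ∈ concat cov) ⇔ InDiag p c
    cov⇔ c = mk⇔
      (λ c∈ → [ All.lookup inD , Equivalence.to (∈-rows⇔InDiag p c) ∘ proj₁ ∘ uncovered⊆ ]′
        (∈-++⁻ (concat css) (subst (c ∈_) concat-cov c∈)))
      λ c∈p → subst (c ∈_) (sym concat-cov) (place c∈p (c ∈? concat css))
      where
      place : InDiag p c → Dec (c ∈ concat css) → c ∈ concat css ++ uncovered
      place c∈p (yes c∈css) = ∈-++⁺ˡ c∈css
      place c∈p (no  c∉css) = ∈-++⁺ʳ (concat css)
        (∈-filter⁺ (¬? ∘ (_∈? concat css)) (Equivalence.from (∈-rows⇔InDiag p c) c∈p) c∉css)

    open ≤-Reasoning

    uncovered-count : truncSum j p + length uncovered ≤ sum p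
    uncovered-count = begin
      truncSum j p + length uncovered        ≤⟨ +-monoˡ-≤ _ size ⟩
      length (concat css) + length uncovered ≤⟨ +-monoˡ-≤ _ (unique-⊆⇒length≤ _ u λ {x} x∈ →
        ∈-filter⁺ (_∈? concat css) (Equivalence.from (∈-rows⇔InDiag p x) (All.lookup inD x∈)) x∈) ⟩
      length (filter (_∈? concat css) cells) + length uncovered
                                             ≡⟨ length-filter-split (_∈? concat css) cells ⟨
      length cells                           ≡⟨ length-concat-rowsFrom 0 p ⟩
      sum p                                  ∎

    -- The matchings take at least `truncSum j p` cells, so at most the excess of the first `k` rows
    -- over length `j` is left.
    uncovered≤ : length uncovered + k * j ≤ sum (take k p)
    uncovered≤ = +-cancelˡ-≤ (truncSum j p) _ _ (begin
      truncSum j p + (length uncovered + k * j) ≡⟨ +-assoc (truncSum j p) _ _ ⟨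
      truncSum j p + length uncovered + k * j   ≤⟨ +-monoˡ-≤ (k * j) uncovered-count ⟩
      sum p + k * j                             ≤⟨ sum+rowLen*k≤ sp k ⟩
      sum (take k p) + truncSum j p             ≡⟨ +-comm (sum (take k p)) _ ⟩
      truncSum j p + sum (take k p)             ∎)

    -- Each of the at most `j` classes counts at most `l`, each singleton at most 1. The term
    -- `k * j` stands on the left to avoid truncated subtraction.
    bound : ∀ l → truncSum l (map length cov) + k * j ≤ j * l + sum (take k p)
    bound l = begin
      truncSum l (map length cov) + k * j
        ≡⟨ cong (λ xs → truncSum l xs + k * j) (map-++ length (filter nonempty? css) _) ⟩
      truncSum l (map length (filter nonempty? css) ++ map length (map [_] uncovered)) + k * j
        ≡⟨ cong (_+ k * j) (truncSum-++ l (map length (filter nonempty? css)) _) ⟩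
      truncSum l (map length (filter nonempty? css)) + truncSum l (map length (map [_] uncovered)) + k * j
        ≤⟨ +-monoˡ-≤ (k * j) (+-mono-≤ classes≤ (truncSum-singletons l uncovered)) ⟩
      j * l + length uncovered + k * j
        ≡⟨ +-assoc (j * l) _ _ ⟩
      j * l + (length uncovered + k * j)
        ≤⟨ +-monoʳ-≤ (j * l) uncovered≤ ⟩
      j * l + sum (take k p) ∎
      where
      classes≤ : truncSum l (map length (filter nonempty? css)) ≤ j * l
      classes≤ = begin
        truncSum l (map length (filter nonempty? css)) ≤⟨ truncSum≤length* l (map length (filter nonempty? css)) ⟩
        length (map length (filter nonempty? css)) * l ≡⟨ cong (_* l) (length-map length (filter nonempty? css)) ⟩
        length (filter nonempty? css) * l              ≤⟨ *-monoˡ-≤ l (length-filter nonempty? css) ⟩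
        length css * l                                 ≡⟨ cong (_* l) len ⟩
        j * l                                          ∎

  -- The top `l` rows form an `l`-clique of size `sum (take l p)`, and weak duality bounds every
  -- `l`-clique by `conjSum cov l`. With the assumed inequality both numbers equal ω_l.
  cover-saturated : ∀ {cov l} → IsStableCover p cov → conjSum cov l ≤ sum (take l p) →
    KSatStable p cov l × conjSum cov l ≡ sum (take l p)
  cover-saturated {cov} {l} isCov le with S , kS , |S| ← top-rows-KClique p l
    with eq ← ≤-antisym le (subst (_≤ conjSum cov l) |S| (kclique≤conjSum p kS isCov)) =
    ((S , kS , trans |S| (sym eq)) , λ T kT → kclique≤conjSum p kT isCov) , eq

  -- In the bound of `stable-cover` the multiples of `j` cancel at `l = k`, and one `j` is left over
  -- at `l = suc k`. As `j` is the length of the next row, it is just what `take (suc k) p` adds, so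
  -- one cover serves both levels.
  saturated-stable-cover : ∀ k → ∃ λ cov → IsStableCover p cov ×
    conjSum cov k ≤ sum (take k p) × conjSum cov (suc k) ≤ sum (take (suc k) p)
  saturated-stable-cover k with cov , isCov , bound ← stable-cover k = cov , isCov , at-k , at-1+k
    where
    open ≤-Reasoning
    j = rowLen p k

    at-k : conjSum cov k ≤ sum (take k p)
    at-k = +-cancelˡ-≤ (j * k) _ _ (begin
      j * k + conjSum cov k               ≡⟨ +-comm (j * k) _ ⟩
      conjSum cov k + j * k               ≡⟨ cong₂ _+_ (conjSum≡truncSum cov k) (*-comm j k) ⟩
      truncSum k (map length cov) + k * j ≤⟨ bound k ⟩
      j * k + sum (take k p)              ∎)

    at-1+k : conjSum cov (suc k) ≤ sum (take (suc k) p)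
    at-1+k = +-cancelˡ-≤ (k * j) _ _ (begin
      k * j + conjSum cov (suc k)               ≡⟨ +-comm (k * j) _ ⟩
      conjSum cov (suc k) + k * j               ≡⟨ cong (_+ k * j) (conjSum≡truncSum cov (suc k)) ⟩
      truncSum (suc k) (map length cov) + k * j ≤⟨ bound (suc k) ⟩
      j * suc k + sum (take k p)                ≡⟨ rearrange j k (sum (take k p)) ⟩
      k * j + (sum (take k p) + j)              ≡⟨ cong (k * j +_) (sum-take-suc p k) ⟨
      k * j + sum (take (suc k) p)              ∎)
      where
      rearrange : ∀ j k s → j * suc k + s ≡ k * j + (s + j)
      rearrange = solve-∀

  omega : ∀ k → IsOmega p k (sum (take k p))
  omega k with cov , isCov , le , _ ← saturated-stable-cover k
    with sat , eq ← cover-saturated {l = k} isCov le = subst (IsOmega p k) eq sat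

  -- Differences are indexed from 1 and rows from 0, hence the shift.
  Δω : ∀ k → Δ (λ l → sum (take l p)) (suc k) ≡ rowLen p k
  Δω k = trans (cong (_∸ sum (take k p)) (sum-take-suc p k)) (m+n∸m≡n (sum (take k p)) _)

  Δα : ∀ k → Δ (conjSum (rows p)) (suc k) ≡ countGe (suc k) p
  Δα k = trans (m+n∸m≡n (conjSum (rows p) k) _) (cong (countGe (suc k)) (map-length-rowsFrom 0 p))

  Δ-conjugacy : DeltaConjugacy p
  Δ-conjugacy = (λ k → sum (take k p)) , conjSum (rows p) , omega , rows-saturated ,
    Δω-antitone , Δα-antitone , conjugate
    where
    Δω-antitone : Nonincreasing (Δ (λ k → sum (take k p)))
    Δω-antitone (suc k) _ rewrite Δω k | Δω (suc k) = rowLen-antitone sp k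

    Δα-antitone : Nonincreasing (Δ (conjSum (rows p)))
    Δα-antitone (suc k) _ rewrite Δα k | Δα (suc k) = countGe-antitone (suc k) p

    conjugate : ConjugateSeq (Δ (λ k → sum (take k p))) (Δ (conjSum (rows p)))
    conjugate (suc i) (suc j) _ _ rewrite Δω i | Δα j =
      mk⇔ (rowLen⇒countGe sp i j) (countGe⇒rowLen sp i j)

  t-phenomenon : TPhenomenon p
  -- The rows serve as clique cover for every `k`, whereas the stable set cover depends on `k`.
  t-phenomenon k _ with cov , isCov , le , le′ ← saturated-stable-cover k =
    (rows p , rows-cover p pos , rows-saturated k , rows-saturated (suc k)) ,
    (cov , isCov , proj₁ (cover-saturated {l = k} isCov le) , proj₁ (cover-saturated {l = suc k} isCov le′))

theorem2 : (p : List ℕ) → IsPartition p → Wide p →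
    CompletelySaturatedCliqueCover p (rows p) × DeltaConjugacy p × TPhenomenon p
theorem2 p (pos , linked) wide =
  (rows-cover p pos , λ k _ → rows-saturated p pos sp wide k) ,
  Δ-conjugacy p pos sp wide , t-phenomenon p pos sp wide
  where
  sp : Sorted p
  sp = Linked⇒AllPairs (λ j≤i k≤j → ≤-trans k≤j j≤i) linked
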